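{- Let $L$ be an intermediate logic algebraized by a variety of Heyting algebras contained in $\mathsf{DHA}$. Then $L$ is hereditarily structurally complete and has the infinite Beth definability property.
   Context: An intermediate logic is a consistent axiomatic extension of intuitionistic propositional logic (closed under substitution and modus ponens), viewed as a consequence relation $\vdash_L$ (derivations from premises using theorems of $L$ and modus ponens); it is algebraized by the variety of Heyting algebras validating its theorems. A finitary consequence relation is structurally complete if every rule admissible in it (i.e. not enlarging its set of theorems when added) is derivable. $L$ is hereditarily structurally complete if every finitary extension of $\vdash_L$ (in the same language, closed under substitutions) is structurally complete. $L$ has the infinite Beth definability property if for all disjoint sets of variables $X,Y$ and every set of formulas $\Gamma(X,Y)$: whenever $\Gamma(X,Y)\cup\Gamma(X,Y')\vdash_L y\leftrightarrow y'$ for every $y\in Y$ (with $Y'$ a disjoint copy of $Y$ and $y'$ the copy of $y$), then for each $y\in Y$ there is a formula $\varphi_y(X)$ with $\Gamma(X,Y)\vdash_L y\leftrightarrow\varphi_y$. For a poset $X$, $\mathrm{Up}(X)$ is the Heyting algebra of upsets. A poset satisfies the three point rule if for all distinct $x,y,z$, if $x,y$ are incomparable and $x\le z$ then $y\le z$. A poset $X$ is a diamond system if: (D1) each ${\uparrow}x=\{y:x\le y\}$ satisfies the three point rule; (D2) no ${\uparrow}x$ contains a $3$-element antichain; (D3) for all $x$ and $y,z\in{\uparrow}x$ there is $w$ with $y,z\le w$; (D4) whenever $\bot\le x,y$, $x,y\le z,v$, $z,v\le\top$, there is $w$ with $x,y\le w\le z,v$. A diamond sequence is a diamond system in which any two elements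 have a common lower bound. $\mathsf{DHA}$ is the variety generated by $\{\mathrm{Up}(X): X$ a finite diamond sequence$\}$. -}

module Defs where

open import Data.Nat using (ℕ)
open import Data.Fin using (Fin)
open import Data.Bool using (Bool; true)
open import Data.List using (List; []; map)
open import Data.List.Membership.Propositional using (_∈_)
open import Data.Product using (Σ; ∃; _×_; _,_)
open import Data.Sum using (_⊎_)
open import Data.Empty using (⊥)
open import Data.Unit using (⊤)
open import Relation.Nullary using (¬_; Dec)
open import Relation.Binary.PropositionalEquality using (_≡_)

infixr 6 _∧_
infixr 5 _∨_
infixr 4 _⇒_ _⇔_

data Formula : Set where
  var  : ℕ → Formula
  ⊥'   : Formula
  _∧_  : Formula → Formula → Formula
  _∨_  : Formula → Formula → Formula
  _⇒_  : Formula → Formula → Formula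

_⇔_ : Formula → Formula → Formula
φ ⇔ ψ = (φ ⇒ ψ) ∧ (ψ ⇒ φ)

Subst : Set
Subst = ℕ → Formula

sub : Subst → Formula → Formula
sub σ (var n) = σ n
sub σ ⊥'      = ⊥'
sub σ (φ ∧ ψ) = sub σ φ ∧ sub σ ψ
sub σ (φ ∨ ψ) = sub σ φ ∨ sub σ ψ
sub σ (φ ⇒ ψ) = sub σ φ ⇒ sub σ ψ

ren : (ℕ → ℕ) → Formula → Formula
ren c = sub (λ n → var (c n))

AllVars : (ℕ → Set) → Formula → Set
AllVars P (var n) = P n
AllVars P ⊥'      = ⊤
AllVars P (φ ∧ ψ) = AllVars P φ × AllVars P ψ
AllVars P (φ ∨ ψ) = AllVars P φ × AllVars P ψ
AllVars P (φ ⇒ ψ) = AllVars P φ × AllVars P ψ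

data IPCAxiom : Formula → Set where
  ax-K   : ∀ φ ψ → IPCAxiom (φ ⇒ ψ ⇒ φ)
  ax-S   : ∀ φ ψ χ → IPCAxiom ((φ ⇒ ψ ⇒ χ) ⇒ (φ ⇒ ψ) ⇒ φ ⇒ χ)
  ax-∧₁  : ∀ φ ψ → IPCAxiom (φ ∧ ψ ⇒ φ)
  ax-∧₂  : ∀ φ ψ → IPCAxiom (φ ∧ ψ ⇒ ψ)
  ax-∧I  : ∀ φ ψ → IPCAxiom (φ ⇒ ψ ⇒ φ ∧ ψ)
  ax-∨₁  : ∀ φ ψ → IPCAxiom (φ ⇒ φ ∨ ψ)
  ax-∨₂  : ∀ φ ψ → IPCAxiom (ψ ⇒ φ ∨ ψ)
  ax-∨E  : ∀ φ ψ χ → IPCAxiom ((φ ⇒ χ) ⇒ (ψ ⇒ χ) ⇒ φ ∨ ψ ⇒ χ)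
  ax-⊥   : ∀ φ → IPCAxiom (⊥' ⇒ φ)

record IntermediateLogic : Set₁ where
  field
    Thm       : Formula → Set
    ipc-cl    : ∀ {φ} → IPCAxiom φ → Thm φ
    mp-cl     : ∀ {φ ψ} → Thm (φ ⇒ ψ) → Thm φ → Thm ψ
    subst-cl  : ∀ σ {φ} → Thm φ → Thm (sub σ φ)
    consistent : ¬ Thm ⊥'
open IntermediateLogic public

data _⊢[_]_ (Γ : Formula → Set) (L : IntermediateLogic) : Formula → Set where
  hyp : ∀ {φ} → Γ φ → Γ ⊢[ L ] φ
  theorem : ∀ {φ} → Thm L φ → Γ ⊢[ L ] φ
  mp  : ∀ {φ ψ} → Γ ⊢[ L ] (φ ⇒ ψ) → Γ ⊢[ L ] φ → Γ ⊢[ L ] ψ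

⟪_⟫ : List Formula → Formula → Set
⟪ Γ ⟫ φ = φ ∈ Γ

-- Finitary structural consequence relations (given by their restriction
-- to finite sets of premises, represented as lists)

record FinConsequence : Set₁ where
  field
    _⊢_    : List Formula → Formula → Set
    reflex : ∀ {Γ φ} → φ ∈ Γ → Γ ⊢ φ
    mono   : ∀ {Γ Δ φ} → (∀ {ψ} → ψ ∈ Γ → ψ ∈ Δ) → Γ ⊢ φ → Δ ⊢ φ
    cut    : ∀ {Γ Δ φ} → (∀ {ψ} → ψ ∈ Δ → Γ ⊢ ψ) → Δ ⊢ φ → Γ ⊢ φ
    struct : ∀ σ {Γ φ} → Γ ⊢ φ → map (sub σ) Γ ⊢ sub σ φ
open FinConsequence public

Admissible : FinConsequence → List Formula → Formula → Set
Admissible R Γ φ =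
  ∀ (σ : Subst) → (∀ {ψ} → ψ ∈ Γ → _⊢_ R [] (sub σ ψ)) → _⊢_ R [] (sub σ φ)

StructurallyComplete : FinConsequence → Set
StructurallyComplete R = ∀ Γ φ → Admissible R Γ φ → _⊢_ R Γ φ

Extends : FinConsequence → IntermediateLogic → Set
Extends R L = ∀ Γ φ → ⟪ Γ ⟫ ⊢[ L ] φ → _⊢_ R Γ φ

HereditarilyStructurallyComplete : IntermediateLogic → Set₁
HereditarilyStructurallyComplete L =
  ∀ (R : FinConsequence) → Extends R L → StructurallyComplete R

InfiniteBeth : IntermediateLogic → Set₁
InfiniteBeth L =
  ∀ (X Y : ℕ → Set) → (∀ n → X n → Y n → ⊥)
  → (Γ : Formula → Set) → (∀ φ → Γ φ → AllVars (λ n → X n ⊎ Y n) φ)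
  → (c : ℕ → ℕ)
  → (∀ x → X x → c x ≡ x)
  → (∀ y y′ → Y y → Y y′ → c y ≡ c y′ → y ≡ y′)
  → (∀ y → Y y → ¬ X (c y) × ¬ Y (c y))
  → (∀ y → Y y →
       (λ φ → Γ φ ⊎ Σ Formula (λ ψ → Γ ψ × φ ≡ ren c ψ)) ⊢[ L ] (var y ⇔ var (c y)))
  → ∀ y → Y y → Σ Formula (λ φ → AllVars X φ × Γ ⊢[ L ] (var y ⇔ φ))

record FinPoset : Set₁ where
  field
    size    : ℕ
    _≤_     : Fin size → Fin size → Set
    _≤?_    : ∀ x y → Dec (x ≤ y)
    ≤-refl  : ∀ {x} → x ≤ x
    ≤-trans : ∀ {x y z} → x ≤ y → y ≤ z → x ≤ z
    ≤-antisym : ∀ {x y} → x ≤ y → y ≤ x → x ≡ y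

module _ (P : FinPoset) where
  open FinPoset P

  Incomparable : Fin size → Fin size → Set
  Incomparable x y = ¬ x ≤ y × ¬ y ≤ x

  D1 : Set
  D1 = ∀ x a b c → x ≤ a → x ≤ b → x ≤ c
       → ¬ a ≡ b → ¬ a ≡ c → ¬ b ≡ c
       → Incomparable a b → a ≤ c → b ≤ c

  D2 : Set
  D2 = ∀ x a b c → x ≤ a → x ≤ b → x ≤ c
       → ¬ a ≡ b → ¬ a ≡ c → ¬ b ≡ c
       → ¬ (Incomparable a b × Incomparable a c × Incomparable b c)

  D3 : Set
  D3 = ∀ x y z → x ≤ y → x ≤ z → ∃ λ w → y ≤ w × z ≤ w

  D4 : Set
  D4 = ∀ b x y z v t → b ≤ x → b ≤ y → x ≤ z → x ≤ v → y ≤ z → y ≤ v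
       → z ≤ t → v ≤ t → ∃ λ w → x ≤ w × y ≤ w × w ≤ z × w ≤ v

  DiamondSystem : Set
  DiamondSystem = D1 × D2 × D3 × D4

  DiamondSequence : Set
  DiamondSequence = DiamondSystem × (∀ x y → ∃ λ z → z ≤ x × z ≤ y)

  record Valuation : Set where
    field
      val    : ℕ → Fin size → Bool
      upward : ∀ n {x y} → x ≤ y → val n x ≡ true → val n y ≡ true
  open Valuation public

  -- x ∈ (value of φ in Up(X) under v); the Heyting operations of Up(X)
  -- are intersection, union, empty set and U → V = {x | ∀ y ≥ x, y ∈ U → y ∈ V}
  _,_∈⟦_⟧ : Valuation → Fin size → Formula → Set
  v , x ∈⟦ var n ⟧ = val v n x ≡ true
  v , x ∈⟦ ⊥' ⟧    = ⊥
  v , x ∈⟦ φ ∧ ψ ⟧ = v , x ∈⟦ φ ⟧ × v , x ∈⟦ ψ ⟧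
  v , x ∈⟦ φ ∨ ψ ⟧ = v , x ∈⟦ φ ⟧ ⊎ v , x ∈⟦ ψ ⟧
  v , x ∈⟦ φ ⇒ ψ ⟧ = ∀ y → x ≤ y → v , y ∈⟦ φ ⟧ → v , y ∈⟦ ψ ⟧

  ValidUp : Formula → Set
  ValidUp φ = ∀ (v : Valuation) x → v , x ∈⟦ φ ⟧

ValidDHA : Formula → Set₁
ValidDHA φ = ∀ (P : FinPoset) → DiamondSequence P → ValidUp P φ

-- The variety algebraizing L is contained in DHA  (⇔ Log(DHA) ⊆ L)
VarietyWithinDHA : IntermediateLogic → Set₁
VarietyWithinDHA L = ∀ φ → ValidDHA φ → Thm L φ

{-# OPTIONS --safe #-}
module Submission where

-- By (D1)-(D4) a finite rooted diamond system is a linear sum of points and two-element antichains, no two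
-- antichains being adjacent and the greatest summand being a point. Up to bisimulation there are finitely
-- many such models on n variables; they form a finite universal model in which every principal upset ↑b is
-- defined by a formula.
--
-- Structural completeness: for each point x of the universal model there is a p-morphism from the
-- universal model onto ↑x that fixes ↑x. It is definable by a substitution, which turns everything true at
-- x into a theorem. So if Γ / φ is admissible, σφ is a theorem for each of the finitely many substitutions
-- σ arising from the models x of Γ, and at x itself σφ is equivalent to φ.
--
-- Beth property: if y is implicitly defined, then in each rooted model of Γ it is equivalent to one of
-- finitely many formulas in X. Otherwise y separates two points bisimilar over X, and a small deformation of
-- the model which is invisible to X moves y. Substituting such candidates for all the Y-variables in the
-- finitely many premises used to prove y ↔ y′ gives the explicit definition, by cases.

open import Defs
open import Data.Bool using (Bool; true; false; if_then_else_) renaming (_∧_ to _&&_; _≟_ to _≟ᵇ_)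
open import Data.Empty using (⊥; ⊥-elim)
open import Data.Fin using (Fin)
open import Data.Fin.Induction using (po-wellFounded; po-noetherian)
open import Data.Fin.Properties using () renaming (_≟_ to _≟ᶠ_; any? to anyᶠ?)
open import Data.List using (List; []; _∷_; _++_; map; filter; cartesianProduct; cartesianProductWith)
open import Data.List.Membership.Propositional using (_∈_; lose; find)
open import Data.List.Membership.Propositional.Properties
  using (∈-++⁺ˡ; ∈-++⁺ʳ; ∈-++⁻; ∈-map⁺; ∈-map⁻; ∈-filter⁺; ∈-filter⁻; ∈-cartesianProduct⁺;
         ∈-cartesianProductWith⁺; ∈-cartesianProductWith⁻)
import Data.List.Relation.Unary.All as All
open import Data.List.Relation.Unary.Any using (here; there; any?)
open import Data.Nat using (ℕ; zero; suc; _+_; _≤_; _<_; z≤n; s≤s; _⊔_; _≟_)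
open import Data.List.Membership.DecPropositional _≟_ using (_∈?_)
open import Data.Nat.Induction using (<-wellFounded)
open import Data.Nat.Properties
  using (≤-refl; ≤-trans; <-irrefl; <-trans; m≤n⇒m≤1+n; m<n⇒m<1+n; n<1+n; m≤m+n; +-monoʳ-<;
         m<1+n⇒m<n∨m≡n; m≤m⊔n; m≤n⊔m)
open import Data.Product using (Σ; ∃; _×_; _,_; proj₁; proj₂)
open import Data.Sum using (_⊎_; inj₁; inj₂)
open import Data.Unit using (⊤; tt)
open import Data.Vec using (Vec; []; _∷_; zipWith)
open import Data.Vec.Properties using (≡-dec)
open import Function using (_∘_; id)
open import Induction.WellFounded using (Acc; acc)
open import Relation.Binary.PropositionalEquality
  using (_≡_; _≢_; refl; sym; trans; cong; cong₂; subst; isEquivalence)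
open import Relation.Binary.Structures using (IsPartialOrder)
open import Relation.Nullary using (¬_; Dec; yes; no; does)
open import Relation.Nullary.Decidable
  using (map′; _×-dec_; _⊎-dec_; _→-dec_; ¬?; dec-true; decidable-stable)
open import Relation.Unary using (Decidable)

-- `L` is an arbitrary extension of the logic of `DHA` and comes without a semantics of its own.
-- Models therefore serve only to show that formulas are valid in `DHA`, hence theorems of `L`;
-- whatever is special to `L`, or to an extension of its consequence relation, enters as
-- substitution instances placed as premises of such valid implications. This is why p-morphisms and
-- deformations have to be realised by substitutions, and why finiteness of the universal model
-- matters: its points, and the maps considered on it, can be listed inside a formula. Two features
-- of the shape of the models carry both halves. Points above a common point are comparable or are
-- the two middle points of one diamond, so the images of two branches can always be joined again.
-- And strictly above a middle point there is only the upset of one point, so it can be moved onto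
-- its sibling or onto that point; the subtlety is that moving the root of a diamond may drag a
-- middle point along.

private variable
  n : ℕ

-- Bit vectors as sets of variables

-- Bits beyond the length read as false.
at : Vec Bool n → ℕ → Bool
at [] _ = false
at (b ∷ v) zero = b
at (b ∷ v) (suc i) = at v i

at-ext : {v w : Vec Bool n} → (∀ i → at v i ≡ at w i) → v ≡ w
at-ext {v = []} {[]} _ = refl
at-ext {v = _ ∷ _} {_ ∷ _} h = cong₂ _∷_ (h 0) (at-ext (h ∘ suc))

at-bound : (v : Vec Bool n) (i : ℕ) → at v i ≡ true → i < n
at-bound (_ ∷ v) zero _ = s≤s z≤n
at-bound (_ ∷ v) (suc i) p = s≤s (at-bound v i p)

tab : ∀ n → (ℕ → Bool) → Vec Bool n
tab zero f = []
tab (suc n) f = f 0 ∷ tab n (f ∘ suc)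

at-tab : ∀ {n} f {i} → i < n → at (tab n f) i ≡ f i
at-tab f {zero} (s≤s _) = refl
at-tab f {suc i} (s≤s p) = at-tab (f ∘ suc) p

at-zipWith-&& : (v w : Vec Bool n) (i : ℕ) → at (zipWith _&&_ v w) i ≡ (at v i && at w i)
at-zipWith-&& [] [] _ = refl
at-zipWith-&& (_ ∷ _) (_ ∷ _) zero = refl
at-zipWith-&& (_ ∷ v) (_ ∷ w) (suc i) = at-zipWith-&& v w i

infix 4 _⊑_ _<ᵥ_ _≼_

record _⊑_ (v w : Vec Bool n) : Set where
  constructor ⊑-intro
  field ⊑-at : ∀ i → at v i ≡ true → at w i ≡ true
open _⊑_ public

⊑-refl : {v : Vec Bool n} → v ⊑ v
⊑-refl = ⊑-intro λ _ e → e

⊑-trans : {u v w : Vec Bool n} → u ⊑ v → v ⊑ w → u ⊑ w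
⊑-trans p q = ⊑-intro λ i e → ⊑-at q i (⊑-at p i e)

⊑-antisym : {v w : Vec Bool n} → v ⊑ w → w ⊑ v → v ≡ w
⊑-antisym {v = v} {w} (⊑-intro p) (⊑-intro q) = at-ext λ i → go (at v i) (at w i) (p i) (q i)
  where
  go : ∀ a b → (a ≡ true → b ≡ true) → (b ≡ true → a ≡ true) → a ≡ b
  go false false _ _ = refl
  go false true _ g = g refl
  go true b f _ = sym (f refl)

zipWith-&&-mono : (m : Vec Bool n) {v w : Vec Bool n} → v ⊑ w → zipWith _&&_ m v ⊑ zipWith _&&_ m w
zipWith-&&-mono m {v} {w} p = ⊑-intro go
  where
  go : ∀ i → at (zipWith _&&_ m v) i ≡ true → at (zipWith _&&_ m w) i ≡ true
  go i e rewrite at-zipWith-&& m v i | at-zipWith-&& m w i with at m i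
  ... | true = ⊑-at p i e

zipWith-&&-⊑ : (m v : Vec Bool n) → zipWith _&&_ m v ⊑ m
zipWith-&&-⊑ m v = ⊑-intro go
  where
  go : ∀ i → at (zipWith _&&_ m v) i ≡ true → at m i ≡ true
  go i e rewrite at-zipWith-&& m v i with at m i
  ... | true = refl

count : Vec Bool n → ℕ
count [] = 0
count (true ∷ v) = suc (count v)
count (false ∷ v) = count v

count≤ : (v : Vec Bool n) → count v ≤ n
count≤ [] = z≤n
count≤ (true ∷ v) = s≤s (count≤ v)
count≤ (false ∷ v) = m≤n⇒m≤1+n (count≤ v)

count-mono : (v w : Vec Bool n) → v ⊑ w → v ≡ w ⊎ count v < count w
count-mono [] [] _ = inj₁ refl
count-mono (a ∷ v) (b ∷ w) p with count-mono v w (⊑-intro (⊑-at p ∘ suc))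
count-mono (true ∷ v) (false ∷ w) p | _ with () ← ⊑-at p 0 refl
count-mono (true ∷ v) (true ∷ w) p | inj₁ refl = inj₁ refl
count-mono (true ∷ v) (true ∷ w) p | inj₂ q = inj₂ (s≤s q)
count-mono (false ∷ v) (false ∷ w) p | inj₁ refl = inj₁ refl
count-mono (false ∷ v) (false ∷ w) p | inj₂ q = inj₂ q
count-mono (false ∷ v) (true ∷ w) p | inj₁ refl = inj₂ ≤-refl
count-mono (false ∷ v) (true ∷ w) p | inj₂ q = inj₂ (m<n⇒m<1+n q)

count-strict : {v w : Vec Bool n} → v ⊑ w → v ≢ w → count v < count w
count-strict {v = v} {w} p ne with count-mono v w p
... | inj₁ e = ⊥-elim (ne e)
... | inj₂ q = q

-- The lexicographic order. It selects one of the two mirror images of a diamond and keeps the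
-- middle points distinct.
data _<ᵥ_ : Vec Bool n → Vec Bool n → Set where
  head : {v w : Vec Bool n} → (false ∷ v) <ᵥ (true ∷ w)
  tail : ∀ {b} {v w : Vec Bool n} → v <ᵥ w → (b ∷ v) <ᵥ (b ∷ w)

<ᵥ-asym : {v w : Vec Bool n} → v <ᵥ w → ¬ w <ᵥ v
<ᵥ-asym (tail p) (tail q) = <ᵥ-asym p q

<ᵥ-irrefl : {v w : Vec Bool n} → v ≡ w → ¬ v <ᵥ w
<ᵥ-irrefl refl p = <ᵥ-asym p p

<ᵥ-cmp : (v w : Vec Bool n) → v <ᵥ w ⊎ v ≡ w ⊎ w <ᵥ v
<ᵥ-cmp [] [] = inj₂ (inj₁ refl)
<ᵥ-cmp (false ∷ v) (true ∷ w) = inj₁ head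
<ᵥ-cmp (true ∷ v) (false ∷ w) = inj₂ (inj₂ head)
<ᵥ-cmp (false ∷ v) (false ∷ w) with <ᵥ-cmp v w
... | inj₁ p = inj₁ (tail p)
... | inj₂ (inj₁ refl) = inj₂ (inj₁ refl)
... | inj₂ (inj₂ p) = inj₂ (inj₂ (tail p))
<ᵥ-cmp (true ∷ v) (true ∷ w) with <ᵥ-cmp v w
... | inj₁ p = inj₁ (tail p)
... | inj₂ (inj₁ refl) = inj₂ (inj₁ refl)
... | inj₂ (inj₂ p) = inj₂ (inj₂ (tail p))

-- Models as codes

-- A code is a rooted model on a linear sum of points and two-element antichains, listed from the
-- root upwards, each point carrying the set of variables it satisfies. In dia v w₁ w₂ c the root v
-- lies below the incomparable points w₁ and w₂, which lie below the root of c.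
data Code (n : ℕ) : Set where
  top : Vec Bool n → Code n
  pt  : Vec Bool n → Code n → Code n
  dia : Vec Bool n → Vec Bool n → Vec Bool n → Code n → Code n

private variable
  v w w₁ w₂ : Vec Bool n
  b c d e : Code n
  φ : Formula

root : Code n → Vec Bool n
root (top v) = v
root (pt v _) = v
root (dia v _ _ _) = v

_≟ᵥ_ : (v w : Vec Bool n) → Dec (v ≡ w)
_≟ᵥ_ = ≡-dec _≟ᵇ_

_≟ᶜ_ : (c d : Code n) → Dec (c ≡ d)
top v ≟ᶜ top w = map′ (cong top) (λ { refl → refl }) (v ≟ᵥ w)
top _ ≟ᶜ pt _ _ = no λ ()
top _ ≟ᶜ dia _ _ _ _ = no λ ()
pt _ _ ≟ᶜ top _ = no λ ()
pt v c ≟ᶜ pt w d = map′ (λ { (refl , refl) → refl }) (λ { refl → refl , refl }) (v ≟ᵥ w ×-dec c ≟ᶜ d)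
pt _ _ ≟ᶜ dia _ _ _ _ = no λ ()
dia _ _ _ _ ≟ᶜ top _ = no λ ()
dia _ _ _ _ ≟ᶜ pt _ _ = no λ ()
dia v w₁ w₂ c ≟ᶜ dia v′ w₁′ w₂′ c′ =
  map′ (λ { (refl , refl , refl , refl) → refl }) (λ { refl → refl , refl , refl , refl })
    (v ≟ᵥ v′ ×-dec w₁ ≟ᵥ w₁′ ×-dec w₂ ≟ᵥ w₂′ ×-dec c ≟ᶜ c′)

-- The points of the model c are the codes of its principal upsets, so all codes together form
-- one big model, in which c ≼ d says that d lies above c.
data _≼_ {n} : Code n → Code n → Set where
  here  : c ≼ c
  up    : c ≼ d → pt v c ≼ d
  left  : ∀ {v w₁ w₂ c d} → pt w₁ c ≼ d → dia v w₁ w₂ c ≼ d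
  right : ∀ {v w₁ w₂ c d} → pt w₂ c ≼ d → dia v w₁ w₂ c ≼ d

≼-trans : b ≼ c → c ≼ d → b ≼ d
≼-trans here q = q
≼-trans (up p) q = up (≼-trans p q)
≼-trans (left p) q = left (≼-trans p q)
≼-trans (right p) q = right (≼-trans p q)

rank : Code n → ℕ
rank (top _) = 0
rank (pt _ c) = suc (rank c)
rank (dia _ _ _ c) = suc (suc (rank c))

≼-rank : c ≼ d → c ≡ d ⊎ rank d < rank c
≼-rank here = inj₁ refl
≼-rank (up p) with ≼-rank p
... | inj₁ refl = inj₂ ≤-refl
... | inj₂ q = inj₂ (m<n⇒m<1+n q)
≼-rank (left p) with ≼-rank p
... | inj₁ refl = inj₂ ≤-refl
... | inj₂ q = inj₂ (m<n⇒m<1+n q)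
≼-rank (right p) with ≼-rank p
... | inj₁ refl = inj₂ ≤-refl
... | inj₂ q = inj₂ (m<n⇒m<1+n q)

≼-antisym : c ≼ d → d ≼ c → c ≡ d
≼-antisym p q with ≼-rank p | ≼-rank q
... | inj₁ e | _ = e
... | inj₂ _ | inj₁ e = sym e
... | inj₂ x | inj₂ y = ⊥-elim (<-irrefl refl (<-trans x y))

pt-irrefl : ¬ c ≼ pt v c
pt-irrefl p with ≼-rank p
... | inj₁ ()
... | inj₂ q = <-irrefl refl (<-trans q (n<1+n _))

pt≼pt : pt v c ≼ pt w c → v ≡ w
pt≼pt here = refl
pt≼pt (up p) = ⊥-elim (pt-irrefl p)

ups : Code n → List (Code n)
ups c@(top _) = c ∷ []
ups c@(pt _ d) = c ∷ ups d
ups c@(dia _ w₁ w₂ d) = c ∷ pt w₁ d ∷ pt w₂ d ∷ ups d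

≼⇒∈ups : c ≼ d → d ∈ ups c
≼⇒∈ups {c = top _} here = here refl
≼⇒∈ups {c = pt _ _} here = here refl
≼⇒∈ups {c = dia _ _ _ _} here = here refl
≼⇒∈ups (up p) = there (≼⇒∈ups p)
≼⇒∈ups (left here) = there (here refl)
≼⇒∈ups (left (up p)) = there (there (there (≼⇒∈ups p)))
≼⇒∈ups (right here) = there (there (here refl))
≼⇒∈ups (right (up p)) = there (there (there (≼⇒∈ups p)))

∈ups⇒≼ : d ∈ ups c → c ≼ d
∈ups⇒≼ {c = top _} (here refl) = here
∈ups⇒≼ {c = pt _ _} (here refl) = here
∈ups⇒≼ {c = pt _ _} (there p) = up (∈ups⇒≼ p)
∈ups⇒≼ {c = dia _ _ _ _} (here refl) = here
∈ups⇒≼ {c = dia _ _ _ _} (there (here refl)) = left here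
∈ups⇒≼ {c = dia _ _ _ _} (there (there (here refl))) = right here
∈ups⇒≼ {c = dia _ _ _ _} (there (there (there p))) = left (up (∈ups⇒≼ p))

_≼?_ : (c d : Code n) → Dec (c ≼ d)
c ≼? d = map′ ∈ups⇒≼ ≼⇒∈ups (any? (d ≟ᶜ_) (ups c))

Siblings : Code n → Code n → Code n → Set
Siblings c d e = ∃ λ v → ∃ λ w₁ → ∃ λ w₂ → ∃ λ t → c ≼ dia v w₁ w₂ t
  × ((d ≡ pt w₁ t × e ≡ pt w₂ t) ⊎ (d ≡ pt w₂ t × e ≡ pt w₁ t))

-- Two paths can part only at a diamond. There either both stop at its middle points, or one of them
-- continues into the common part, which lies above both sides.
≼-linear : c ≼ d → c ≼ e → d ≼ e ⊎ e ≼ d ⊎ Siblings c d e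
≼-linear here q = inj₁ q
≼-linear p@(up _) here = inj₂ (inj₁ p)
≼-linear p@(left _) here = inj₂ (inj₁ p)
≼-linear p@(right _) here = inj₂ (inj₁ p)
≼-linear (up p) (up q) with ≼-linear p q
... | inj₁ r = inj₁ r
... | inj₂ (inj₁ r) = inj₂ (inj₁ r)
... | inj₂ (inj₂ (_ , _ , _ , _ , r , s)) = inj₂ (inj₂ (_ , _ , _ , _ , up r , s))
≼-linear (left p) (left q) with ≼-linear p q
... | inj₁ r = inj₁ r
... | inj₂ (inj₁ r) = inj₂ (inj₁ r)
... | inj₂ (inj₂ (_ , _ , _ , _ , r , s)) = inj₂ (inj₂ (_ , _ , _ , _ , left r , s))
≼-linear (right p) (right q) with ≼-linear p q
... | inj₁ r = inj₁ r
... | inj₂ (inj₁ r) = inj₂ (inj₁ r)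
... | inj₂ (inj₂ (_ , _ , _ , _ , r , s)) = inj₂ (inj₂ (_ , _ , _ , _ , right r , s))
≼-linear (left here) (right here) = inj₂ (inj₂ (_ , _ , _ , _ , here , inj₁ (refl , refl)))
≼-linear (left here) (right (up q)) = inj₁ (up q)
≼-linear (left (up p)) (right here) = inj₂ (inj₁ (up p))
≼-linear (left (up p)) (right (up q)) with ≼-linear p q
... | inj₁ r = inj₁ r
... | inj₂ (inj₁ r) = inj₂ (inj₁ r)
... | inj₂ (inj₂ (_ , _ , _ , _ , r , s)) = inj₂ (inj₂ (_ , _ , _ , _ , left (up r) , s))
≼-linear (right here) (left here) = inj₂ (inj₂ (_ , _ , _ , _ , here , inj₂ (refl , refl)))
≼-linear (right here) (left (up q)) = inj₁ (up q)
≼-linear (right (up p)) (left here) = inj₂ (inj₁ (up p))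
≼-linear (right (up p)) (left (up q)) with ≼-linear p q
... | inj₁ r = inj₁ r
... | inj₂ (inj₁ r) = inj₂ (inj₁ r)
... | inj₂ (inj₂ (_ , _ , _ , _ , r , s)) = inj₂ (inj₂ (_ , _ , _ , _ , left (up r) , s))

-- The value at the greatest point. It is constant along `≼`, so codes with different `last` have no
-- point in common.
last : Code n → Vec Bool n
last (top v) = v
last (pt _ c) = last c
last (dia _ _ _ c) = last c

last-≼ : c ≼ d → last c ≡ last d
last-≼ here = refl
last-≼ (up p) = last-≼ p
last-≼ (left p) = last-≼ p
last-≼ (right p) = last-≼ p

≼-last : (c : Code n) → c ≼ top (last c)
≼-last (top _) = here
≼-last (pt _ c) = up (≼-last c)
≼-last (dia _ _ _ c) = left (up (≼-last c))

Persistent : Code n → Set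
Persistent (top v) = ⊤
Persistent (pt v c) = v ⊑ root c × Persistent c
Persistent (dia v w₁ w₂ c) = v ⊑ w₁ × v ⊑ w₂ × w₁ ⊑ root c × w₂ ⊑ root c × Persistent c

persistent-≼ : Persistent c → c ≼ d → Persistent d
persistent-≼ p here = p
persistent-≼ (_ , p) (up q) = persistent-≼ p q
persistent-≼ (_ , _ , x , _ , p) (left q) = persistent-≼ (x , p) q
persistent-≼ (_ , _ , _ , x , p) (right q) = persistent-≼ (x , p) q

root-mono : Persistent c → c ≼ d → root c ⊑ root d
root-mono p here = ⊑-refl
root-mono (x , p) (up q) = ⊑-trans x (root-mono p q)
root-mono (x , _ , y , _ , p) (left q) = ⊑-trans x (root-mono (y , p) q)
root-mono (_ , x , _ , y , p) (right q) = ⊑-trans x (root-mono (y , p) q)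

-- Distinct points of a reduced code satisfy different formulas; the order w₁ <ᵥ w₂ removes the
-- symmetry of antichains.
Reduced : Vec Bool n → Code n → Set
Reduced m (top v) = v ⊑ m
Reduced m (pt v c) = v ⊑ root c × v ≢ root c × Reduced m c
Reduced m (dia v w₁ w₂ c) =
  v ⊑ w₁ × v ⊑ w₂ × w₁ <ᵥ w₂ × (w₁ ⊑ root c × w₁ ≢ root c) × (w₂ ⊑ root c × w₂ ≢ root c) × Reduced m c

private variable m : Vec Bool n

reduced⇒persistent : (c : Code n) → Reduced m c → Persistent c
reduced⇒persistent (top _) _ = _
reduced⇒persistent (pt _ c) (x , _ , r) = x , reduced⇒persistent c r
reduced⇒persistent (dia _ _ _ c) (x , y , _ , (z , _) , (u , _) , r) =
  x , y , z , u , reduced⇒persistent c r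

reduced-≼ : Reduced m c → c ≼ d → Reduced m d
reduced-≼ r here = r
reduced-≼ (_ , _ , r) (up p) = reduced-≼ r p
reduced-≼ (_ , _ , _ , (x , y) , _ , r) (left p) = reduced-≼ (x , y , r) p
reduced-≼ (_ , _ , _ , _ , (x , y) , r) (right p) = reduced-≼ (x , y , r) p

reduced-root : (c : Code n) → Reduced m c → root c ⊑ m
reduced-root (top _) r = r
reduced-root (pt _ c) (x , _ , r) = ⊑-trans x (reduced-root c r)
reduced-root (dia _ _ _ c) (x , _ , _ , (y , _) , _ , r) = ⊑-trans x (⊑-trans y (reduced-root c r))

depth : Code n → ℕ
depth (top _) = 1
depth (pt _ c) = suc (depth c)
depth (dia _ _ _ c) = suc (depth c)

-- Each layer adds at least one bit to the root. This holds across a diamond too: its root may agree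
-- with a middle point, but that point differs from the one above. Hence there are at most n + 1
-- layers, which makes the universal model finite.
depth-bound : (c : Code n) → Reduced m c → depth c + count (root c) ≤ suc n
depth-bound (top v) _ = s≤s (count≤ v)
depth-bound (pt v c) (x , y , r) = ≤-trans (+-monoʳ-< (depth c) (count-strict x y)) (depth-bound c r)
depth-bound (dia v w₁ w₂ c) (x , _ , _ , (y , ne) , _ , r) =
  ≤-trans (+-monoʳ-< (depth c) (count-strict (⊑-trans x y) v≢)) (depth-bound c r)
  where
  v≢ : v ≢ root c
  v≢ refl = ne (⊑-antisym y x)

bits : ∀ n → List (Vec Bool n)
bits zero = [] ∷ []
bits (suc n) = cartesianProductWith _∷_ (true ∷ false ∷ []) (bits n)

∈-bits : (v : Vec Bool n) → v ∈ bits n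
∈-bits [] = here refl
∈-bits (true ∷ v) = ∈-cartesianProductWith⁺ _∷_ {true ∷ false ∷ []} (here refl) (∈-bits v)
∈-bits (false ∷ v) = ∈-cartesianProductWith⁺ _∷_ {true ∷ false ∷ []} (there (here refl)) (∈-bits v)

codes : ℕ → List (Code n)
codes zero = []
codes {n} (suc k) =
  map top (bits n)
    ++ cartesianProductWith pt (bits n) (codes k)
    ++ cartesianProductWith (λ f c → f c)
         (cartesianProductWith (λ f w → f w) (cartesianProductWith dia (bits n) (bits n)) (bits n)) (codes k)

∈-codes : ∀ k (c : Code n) → depth c ≤ k → c ∈ codes k
∈-codes (suc k) (top v) _ = ∈-++⁺ˡ (∈-map⁺ top (∈-bits v))
∈-codes (suc k) (pt v c) (s≤s p) =
  ∈-++⁺ʳ (map top (bits _)) (∈-++⁺ˡ (∈-cartesianProductWith⁺ pt (∈-bits v) (∈-codes k c p)))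
∈-codes (suc k) (dia v w₁ w₂ c) (s≤s p) =
  ∈-++⁺ʳ (map top (bits _)) (∈-++⁺ʳ (cartesianProductWith pt (bits _) (codes k))
    (∈-cartesianProductWith⁺ _
      (∈-cartesianProductWith⁺ _ (∈-cartesianProductWith⁺ dia (∈-bits v) (∈-bits w₁)) (∈-bits w₂))
      (∈-codes k c p)))

reducedCodes : ∀ n → List (Code n)
reducedCodes n = codes (suc n)

∈-reducedCodes : (c : Code n) → Reduced m c → c ∈ reducedCodes n
∈-reducedCodes c r = ∈-codes _ c (≤-trans (m≤m+n _ _) (depth-bound c r))

-- Kripke semantics, substitution and bisimulation

infix 1 _⟷_

_⟷_ : Set → Set → Set
A ⟷ B = (A → B) × (B → A)

≡⇒⟷ : {A B : Set} → A ≡ B → A ⟷ B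
≡⇒⟷ refl = id , id

module Kripke {W : Set} (_≤_ : W → W → Set) (V : W → ℕ → Set) where

  infix 3 _⊩_

  _⊩_ : W → Formula → Set
  x ⊩ var i = V x i
  x ⊩ ⊥' = ⊥
  x ⊩ φ ∧ ψ = x ⊩ φ × x ⊩ ψ
  x ⊩ φ ∨ ψ = x ⊩ φ ⊎ x ⊩ ψ
  x ⊩ φ ⇒ ψ = ∀ y → x ≤ y → y ⊩ φ → y ⊩ ψ

module _ {W : Set} (_≤_ : W → W → Set) (V : W → ℕ → Set) where
  private
    module K = Kripke _≤_ V

  forces-sub : (σ : Subst) → ∀ φ {x} → Kripke._⊩_ _≤_ (λ y i → y K.⊩ σ i) x φ ⟷ x K.⊩ sub σ φ
  forces-sub σ (var i) = id , id
  forces-sub σ ⊥' = id , id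
  forces-sub σ (φ ∧ ψ) =
    (λ (p , q) → proj₁ (forces-sub σ φ) p , proj₁ (forces-sub σ ψ) q) ,
    (λ (p , q) → proj₂ (forces-sub σ φ) p , proj₂ (forces-sub σ ψ) q)
  forces-sub σ (φ ∨ ψ) =
    (λ { (inj₁ p) → inj₁ (proj₁ (forces-sub σ φ) p) ; (inj₂ p) → inj₂ (proj₁ (forces-sub σ ψ) p) }) ,
    (λ { (inj₁ p) → inj₁ (proj₂ (forces-sub σ φ) p) ; (inj₂ p) → inj₂ (proj₂ (forces-sub σ ψ) p) })
  forces-sub σ (φ ⇒ ψ) =
    (λ h y l p → proj₁ (forces-sub σ ψ) (h y l (proj₂ (forces-sub σ φ) p))) ,
    (λ h y l p → proj₂ (forces-sub σ ψ) (h y l (proj₁ (forces-sub σ φ) p)))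

module _ {W₁ W₂ : Set} (_≤₁_ : W₁ → W₁ → Set) (V₁ : W₁ → ℕ → Set)
         (_≤₂_ : W₂ → W₂ → Set) (V₂ : W₂ → ℕ → Set)
         (P : ℕ → Set) (Z : W₁ → W₂ → Set)
         (atoms : ∀ {x y} i → P i → Z x y → V₁ x i ⟷ V₂ y i)
         (forth : ∀ {x y x′} → Z x y → x ≤₁ x′ → ∃ λ y′ → y ≤₂ y′ × Z x′ y′)
         (back : ∀ {x y y′} → Z x y → y ≤₂ y′ → ∃ λ x′ → x ≤₁ x′ × Z x′ y′) where
  private
    module K₁ = Kripke _≤₁_ V₁
    module K₂ = Kripke _≤₂_ V₂

  -- Stated for relations and for restricted sets of variables, so that it covers encodings of
  -- posets, reduction, and p-morphisms whose source is valued by a substitution.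
  bisimulation : ∀ φ → AllVars P φ → ∀ {x y} → Z x y → x K₁.⊩ φ ⟷ y K₂.⊩ φ
  bisimulation (var i) p z = atoms i p z
  bisimulation ⊥' _ z = id , id
  bisimulation (φ ∧ ψ) (p , q) z =
    let f = bisimulation φ p z ; g = bisimulation ψ q z in
    (λ (a , b) → proj₁ f a , proj₁ g b) , (λ (a , b) → proj₂ f a , proj₂ g b)
  bisimulation (φ ∨ ψ) (p , q) z =
    let f = bisimulation φ p z ; g = bisimulation ψ q z in
    (λ { (inj₁ a) → inj₁ (proj₁ f a) ; (inj₂ a) → inj₂ (proj₁ g a) }) ,
    (λ { (inj₁ a) → inj₁ (proj₂ f a) ; (inj₂ a) → inj₂ (proj₂ g a) })
  bisimulation (φ ⇒ ψ) (p , q) z =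
    (λ h y′ l a → let (x′ , l′ , z′) = back z l in
      proj₁ (bisimulation ψ q z′) (h x′ l′ (proj₂ (bisimulation φ p z′) a))) ,
    (λ h x′ l a → let (y′ , l′ , z′) = forth z l in
      proj₂ (bisimulation ψ q z′) (h y′ l′ (proj₁ (bisimulation φ p z′) a)))

allVars-⊤ : ∀ φ → AllVars (λ _ → ⊤) φ
allVars-⊤ (var _) = tt
allVars-⊤ ⊥' = tt
allVars-⊤ (φ ∧ ψ) = allVars-⊤ φ , allVars-⊤ ψ
allVars-⊤ (φ ∨ ψ) = allVars-⊤ φ , allVars-⊤ ψ
allVars-⊤ (φ ⇒ ψ) = allVars-⊤ φ , allVars-⊤ ψ

atom : Code n → ℕ → Set
atom c i = at (root c) i ≡ true

module _ {n : ℕ} where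
  open Kripke (_≼_ {n}) atom public

persistence : Persistent c → ∀ φ → c ≼ d → c ⊩ φ → d ⊩ φ
persistence p (var i) l a = ⊑-at (root-mono p l) i a
persistence p (φ ∧ ψ) l (a , b) = persistence p φ l a , persistence p ψ l b
persistence p (φ ∨ ψ) l (inj₁ a) = inj₁ (persistence p φ l a)
persistence p (φ ∨ ψ) l (inj₂ a) = inj₂ (persistence p ψ l a)
persistence p (φ ⇒ ψ) l a e l′ = a e (≼-trans l l′)

_⊩?_ : (c : Code n) (φ : Formula) → Dec (c ⊩ φ)
c ⊩? var i = at (root c) i ≟ᵇ true
c ⊩? ⊥' = no λ ()
c ⊩? (φ ∧ ψ) = (c ⊩? φ) ×-dec (c ⊩? ψ)
c ⊩? (φ ∨ ψ) = (c ⊩? φ) ⊎-dec (c ⊩? ψ)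
c ⊩? (φ ⇒ ψ) = map′ (λ a e l p → All.lookup a (≼⇒∈ups l) p) (λ h → All.tabulate λ {e} l p → h e (∈ups⇒≼ l) p)
    (All.all? (λ e → (e ⊩? φ) →-dec (e ⊩? ψ)) (ups c))

-- Reduction

reduce-pt : Vec Bool n → Code n → Code n
reduce-pt v c with v ≟ᵥ root c
... | yes _ = c
... | no _ = pt v c

-- A diamond degenerates to a chain when a middle point repeats the point above it or its sibling. A
-- root that agrees with one middle point is kept, since it sees the other one.
reduce-dia : Vec Bool n → Vec Bool n → Vec Bool n → Code n → Code n
reduce-dia v w₁ w₂ c with w₁ ≟ᵥ root c | w₂ ≟ᵥ root c | <ᵥ-cmp w₁ w₂
... | yes _ | _ | _ = reduce-pt v (reduce-pt w₂ c)
... | no _ | yes _ | _ = reduce-pt v (reduce-pt w₁ c)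
... | no _ | no _ | inj₁ _ = dia v w₁ w₂ c
... | no _ | no _ | inj₂ (inj₁ _) = reduce-pt v (reduce-pt w₁ c)
... | no _ | no _ | inj₂ (inj₂ _) = dia v w₂ w₁ c

-- Forgets the variables outside `m` and minimises. On persistent codes, equality of reducts is
-- bisimilarity over `m`.
reduce : Vec Bool n → Code n → Code n
reduce m (top v) = top (zipWith _&&_ m v)
reduce m (pt v c) = reduce-pt (zipWith _&&_ m v) (reduce m c)
reduce m (dia v w₁ w₂ c) =
  reduce-dia (zipWith _&&_ m v) (zipWith _&&_ m w₁) (zipWith _&&_ m w₂) (reduce m c)

root-reduce-pt : (v : Vec Bool n) (c : Code n) → root (reduce-pt v c) ≡ v
root-reduce-pt v c with v ≟ᵥ root c
... | yes e = sym e
... | no _ = refl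

root-reduce-dia : (v w₁ w₂ : Vec Bool n) (c : Code n) → root (reduce-dia v w₁ w₂ c) ≡ v
root-reduce-dia v w₁ w₂ c with w₁ ≟ᵥ root c | w₂ ≟ᵥ root c | <ᵥ-cmp w₁ w₂
... | yes _ | _ | _ = root-reduce-pt v _
... | no _ | yes _ | _ = root-reduce-pt v _
... | no _ | no _ | inj₁ _ = refl
... | no _ | no _ | inj₂ (inj₁ _) = root-reduce-pt v _
... | no _ | no _ | inj₂ (inj₂ _) = refl

root-reduce : (m : Vec Bool n) (c : Code n) → root (reduce m c) ≡ zipWith _&&_ m (root c)
root-reduce m (top v) = refl
root-reduce m (pt v c) = root-reduce-pt _ _
root-reduce m (dia v w₁ w₂ c) = root-reduce-dia _ (zipWith _&&_ m w₁) (zipWith _&&_ m w₂) (reduce m c)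

reduce-pt-reduced : (v : Vec Bool n) (c : Code n) → v ⊑ root c → Reduced m c → Reduced m (reduce-pt v c)
reduce-pt-reduced v c p r with v ≟ᵥ root c
... | yes _ = r
... | no ne = p , ne , r

reduce-dia-reduced : (v w₁ w₂ : Vec Bool n) (c : Code n) → v ⊑ w₁ → v ⊑ w₂ → w₁ ⊑ root c → w₂ ⊑ root c →
  Reduced m c → Reduced m (reduce-dia v w₁ w₂ c)
reduce-dia-reduced v w₁ w₂ c p q x y r with w₁ ≟ᵥ root c | w₂ ≟ᵥ root c | <ᵥ-cmp w₁ w₂
... | yes _ | _ | _ =
  reduce-pt-reduced v _ (subst (v ⊑_) (sym (root-reduce-pt w₂ c)) q) (reduce-pt-reduced w₂ c y r)
... | no _ | yes _ | _ =
  reduce-pt-reduced v _ (subst (v ⊑_) (sym (root-reduce-pt w₁ c)) p) (reduce-pt-reduced w₁ c x r)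
... | no ne | no ne′ | inj₁ l = p , q , l , (x , ne) , (y , ne′) , r
... | no _ | no _ | inj₂ (inj₁ _) =
  reduce-pt-reduced v _ (subst (v ⊑_) (sym (root-reduce-pt w₁ c)) p) (reduce-pt-reduced w₁ c x r)
... | no ne | no ne′ | inj₂ (inj₂ l) = q , p , l , (y , ne′) , (x , ne) , r

reduce-reduced : (m : Vec Bool n) (c : Code n) → Persistent c → Reduced m (reduce m c)
reduce-reduced m (top v) _ = zipWith-&&-⊑ m v
reduce-reduced m (pt v c) (p , q) =
  reduce-pt-reduced _ _ (subst (_ ⊑_) (sym (root-reduce m c)) (zipWith-&&-mono m p)) (reduce-reduced m c q)
reduce-reduced m (dia v w₁ w₂ c) (p , q , x , y , r) =
  reduce-dia-reduced _ _ _ (reduce m c) (zipWith-&&-mono m p) (zipWith-&&-mono m q)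
    (subst (_ ⊑_) (sym (root-reduce m c)) (zipWith-&&-mono m x))
    (subst (_ ⊑_) (sym (root-reduce m c)) (zipWith-&&-mono m y)) (reduce-reduced m c r)

reduce-pt-≼ : (v : Vec Bool n) (c : Code n) → reduce-pt v c ≼ c
reduce-pt-≼ v c with v ≟ᵥ root c
... | yes _ = here
... | no _ = up here

reduce-pt-id : v ≡ root c → reduce-pt v c ≡ c
reduce-pt-id {v = v} {c} e with v ≟ᵥ root c
... | yes _ = refl
... | no ne = ⊥-elim (ne e)

reduce-pt-new : v ≢ root c → reduce-pt v c ≡ pt v c
reduce-pt-new {v = v} {c} ne with v ≟ᵥ root c
... | yes e = ⊥-elim (ne e)
... | no _ = refl

reduce-dia-left : (v w₁ w₂ : Vec Bool n) (c : Code n) → reduce-dia v w₁ w₂ c ≼ reduce-pt w₁ c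
reduce-dia-left v w₁ w₂ c with w₁ ≟ᵥ root c | w₂ ≟ᵥ root c | <ᵥ-cmp w₁ w₂
... | yes _ | _ | _ = ≼-trans (reduce-pt-≼ v _) (reduce-pt-≼ w₂ c)
... | no ne | yes _ | _ rewrite reduce-pt-new {c = c} ne = reduce-pt-≼ v _
... | no _ | no _ | inj₁ _ = left here
... | no ne | no _ | inj₂ (inj₁ _) rewrite reduce-pt-new {c = c} ne = reduce-pt-≼ v _
... | no _ | no _ | inj₂ (inj₂ _) = right here

reduce-dia-right : (v w₁ w₂ : Vec Bool n) (c : Code n) → reduce-dia v w₁ w₂ c ≼ reduce-pt w₂ c
reduce-dia-right v w₁ w₂ c with w₁ ≟ᵥ root c | w₂ ≟ᵥ root c | <ᵥ-cmp w₁ w₂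
... | yes _ | yes e | _ rewrite reduce-pt-id {c = c} e = reduce-pt-≼ v _
... | yes _ | no ne | _ rewrite reduce-pt-new {c = c} ne = reduce-pt-≼ v _
... | no _ | yes _ | _ = ≼-trans (reduce-pt-≼ v _) (reduce-pt-≼ w₁ c)
... | no _ | no _ | inj₁ _ = right here
... | no ne | no _ | inj₂ (inj₁ refl) rewrite reduce-pt-new {c = c} ne = reduce-pt-≼ v _
... | no _ | no _ | inj₂ (inj₂ _) = left here

reduce-pt-back : (v : Vec Bool n) (c : Code n) → reduce-pt v c ≼ d → d ≡ reduce-pt v c ⊎ c ≼ d
reduce-pt-back v c l with v ≟ᵥ root c
reduce-pt-back v c l | yes _ = inj₂ l
reduce-pt-back v c here | no _ = inj₁ refl
reduce-pt-back v c (up l) | no _ = inj₂ l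

reduce-dia-back : (v w₁ w₂ : Vec Bool n) (c : Code n) → reduce-dia v w₁ w₂ c ≼ d →
  d ≡ reduce-dia v w₁ w₂ c ⊎ reduce-pt w₁ c ≼ d ⊎ reduce-pt w₂ c ≼ d
reduce-dia-back v w₁ w₂ c l with w₁ ≟ᵥ root c
reduce-dia-back v w₁ w₂ c l | yes _ with reduce-pt-back v _ l
... | inj₁ e = inj₁ e
... | inj₂ l′ = inj₂ (inj₂ l′)
reduce-dia-back v w₁ w₂ c l | no ne with w₂ ≟ᵥ root c | <ᵥ-cmp w₁ w₂
reduce-dia-back v w₁ w₂ c l | no ne | yes _ | _ with reduce-pt-back v _ l
... | inj₁ e = inj₁ e
... | inj₂ l′ rewrite reduce-pt-new {c = c} ne = inj₂ (inj₁ l′)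
reduce-dia-back v w₁ w₂ c l | no ne | no _ | inj₂ (inj₁ _) with reduce-pt-back v _ l
... | inj₁ e = inj₁ e
... | inj₂ l′ rewrite reduce-pt-new {c = c} ne = inj₂ (inj₁ l′)
reduce-dia-back v w₁ w₂ c here | no _ | no _ | inj₁ _ = inj₁ refl
reduce-dia-back v w₁ w₂ c (left l) | no _ | no _ | inj₁ _ = inj₂ (inj₁ l)
reduce-dia-back v w₁ w₂ c (right l) | no _ | no _ | inj₁ _ = inj₂ (inj₂ l)
reduce-dia-back v w₁ w₂ c here | no _ | no _ | inj₂ (inj₂ _) = inj₁ refl
reduce-dia-back v w₁ w₂ c (left l) | no _ | no _ | inj₂ (inj₂ _) = inj₂ (inj₂ l)
reduce-dia-back v w₁ w₂ c (right l) | no _ | no _ | inj₂ (inj₂ _) = inj₂ (inj₁ l)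

reduce-mono : (m : Vec Bool n) → c ≼ d → reduce m c ≼ reduce m d
reduce-mono m here = here
reduce-mono m (up l) = ≼-trans (reduce-pt-≼ _ _) (reduce-mono m l)
reduce-mono m (left {w₁ = w₁} {w₂} {c} l) =
  ≼-trans (reduce-dia-left _ (zipWith _&&_ m w₁) (zipWith _&&_ m w₂) (reduce m c)) (reduce-mono m l)
reduce-mono m (right {w₁ = w₁} {w₂} {c} l) =
  ≼-trans (reduce-dia-right _ (zipWith _&&_ m w₁) (zipWith _&&_ m w₂) (reduce m c)) (reduce-mono m l)

-- Together with `reduce-mono`, this makes `reduce m` a p-morphism.
reduce-back : (m : Vec Bool n) (c : Code n) → reduce m c ≼ d → ∃ λ c′ → c ≼ c′ × reduce m c′ ≡ d
reduce-back m c@(top _) here = c , here , refl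
reduce-back m c@(pt v c₀) l with reduce-pt-back (zipWith _&&_ m v) (reduce m c₀) l
... | inj₁ refl = c , here , refl
... | inj₂ l′ = let (c′ , p , e) = reduce-back m c₀ l′ in c′ , up p , e
reduce-back m c@(dia v w₁ w₂ c₀) l
  with reduce-dia-back (zipWith _&&_ m v) (zipWith _&&_ m w₁) (zipWith _&&_ m w₂) (reduce m c₀) l
... | inj₁ refl = c , here , refl
... | inj₂ (inj₁ l′) with reduce-pt-back (zipWith _&&_ m w₁) (reduce m c₀) l′
...   | inj₁ refl = pt w₁ c₀ , left here , refl
...   | inj₂ l″ = let (c′ , p , e) = reduce-back m c₀ l″ in c′ , left (up p) , e
reduce-back m c@(dia v w₁ w₂ c₀) l | inj₂ (inj₂ l′) with reduce-pt-back (zipWith _&&_ m w₂) (reduce m c₀) l′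
...   | inj₁ refl = pt w₂ c₀ , right here , refl
...   | inj₂ l″ = let (c′ , p , e) = reduce-back m c₀ l″ in c′ , left (up p) , e

at-reduce : (m : Vec Bool n) (c : Code n) → ∀ {i} → at m i ≡ true → at (root (reduce m c)) i ≡ at (root c) i
at-reduce m c {i} p rewrite root-reduce m c | at-zipWith-&& m (root c) i | p = refl

reduce-forces : (m : Vec Bool n) → ∀ φ → AllVars (λ i → at m i ≡ true) φ → c ⊩ φ ⟷ reduce m c ⊩ φ
reduce-forces m φ p = bisimulation _≼_ atom _≼_ atom _ (λ c d → d ≡ reduce m c)
  (λ { {x} i p refl → ≡⇒⟷ (cong (_≡ true) (sym (at-reduce m x p))) })
  (λ { {x′ = x′} refl l → reduce m x′ , reduce-mono m l , refl })
  (λ { {x} refl l → let (c′ , l′ , e) = reduce-back m x l in c′ , l′ , sym e })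
  φ p refl

-- Finite diamond sequences

module _ (P : FinPoset) where
  open FinPoset P
    renaming (_≤_ to _⊴_; _≤?_ to _⊴?_; ≤-refl to ⊴-refl; ≤-trans to ⊴-trans; ≤-antisym to ⊴-antisym)

  isPartialOrder : IsPartialOrder _≡_ _⊴_
  isPartialOrder = record
    { isPreorder = record
        { isEquivalence = isEquivalence
        ; reflexive = λ { refl → ⊴-refl }
        ; trans = ⊴-trans }
    ; antisym = ⊴-antisym }

  minimal-below : {Q : Fin size → Set} → Decidable Q → ∀ {x} → Q x →
    ∃ λ t → t ⊴ x × Q t × (∀ y → Q y → y ⊴ t → y ≡ t)
  minimal-below {Q} Q? {x} qx = go x (po-wellFounded isPartialOrder x) qx
    where
    go : ∀ x → Acc _ x → Q x → ∃ λ t → t ⊴ x × Q t × (∀ y → Q y → y ⊴ t → y ≡ t)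
    go x (acc rs) qx with anyᶠ? (λ y → Q? y ×-dec (y ⊴? x ×-dec ¬? (y ≟ᶠ x)))
    ... | yes (y , qy , l , ne) = let (t , l′ , r) = go y (rs (l , ne)) qy in t , ⊴-trans l′ l , r
    ... | no ¬y = x , ⊴-refl , qx , λ y qy l → decidable-stable (y ≟ᶠ x) λ ne → ¬y (y , qy , l , ne)

  data Shape (x : Fin size) : Set where
    maximal : (∀ y → x ⊴ y → y ≡ x) → Shape x
    point   : ∀ t → x ⊴ t → t ≢ x → (∀ y → x ⊴ y → y ≡ x ⊎ t ⊴ y) → Shape x
    diamond : ∀ p q t → x ⊴ p → x ⊴ q → p ⊴ t → q ⊴ t → t ≢ x →
      (∀ y → p ⊴ y → y ≡ p ⊎ t ⊴ y) → (∀ y → q ⊴ y → y ≡ q ⊎ t ⊴ y) →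
      (∀ y → x ⊴ y → y ≡ x ⊎ p ⊴ y ⊎ q ⊴ y) → Shape x

  module _ (ds : DiamondSystem P) where
    private
      d1 = proj₁ ds
      d2 = proj₁ (proj₂ ds)
      d3 = proj₁ (proj₂ (proj₂ ds))
      d4 = proj₂ (proj₂ (proj₂ ds))

    -- Let `p` be minimal strictly above `x`, and `q` minimal below a point that escapes the upset
    -- of `p`. (D2) excludes a third minimal point, (D3) gives `p` and `q` a common upper bound,
    -- (D4) makes a minimal one least, and (D1) puts everything strictly above `p` above `q`, and
    -- conversely.
    shape : ∀ x → Shape x
    shape x with anyᶠ? (λ y → x ⊴? y ×-dec ¬? (y ≟ᶠ x))
    ... | no ¬y = maximal λ y l → decidable-stable (y ≟ᶠ x) λ ne → ¬y (y , l , ne)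
    ... | yes (a , ua) with minimal-below (λ y → x ⊴? y ×-dec ¬? (y ≟ᶠ x)) ua
    ... | p , _ , (x⊴p , p≢x) , p-min with anyᶠ? (λ y → (x ⊴? y ×-dec ¬? (y ≟ᶠ x)) ×-dec ¬? (p ⊴? y))
    ... | no ¬y = point p x⊴p p≢x cover
      where
      cover : ∀ y → x ⊴ y → y ≡ x ⊎ p ⊴ y
      cover y l with y ≟ᶠ x
      ... | yes e = inj₁ e
      ... | no ne = inj₂ (decidable-stable (p ⊴? y) λ np → ¬y (y , (l , ne) , np))
    ... | yes (y₀ , uy₀ , p⋬y₀) with minimal-below (λ y → x ⊴? y ×-dec ¬? (y ≟ᶠ x)) uy₀
    ... | q , q⊴y₀ , (x⊴q , q≢x) , q-min =
      diamond p q t x⊴p x⊴q p⊴t q⊴t t≢x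
        (λ y l → p-cover y l) (λ y l → q-cover y l) cover
      where
      p⋬q : ¬ p ⊴ q
      p⋬q l = p⋬y₀ (⊴-trans l q⊴y₀)

      q⋬p : ¬ q ⊴ p
      q⋬p l with refl ← p-min q (x⊴q , q≢x) l = p⋬q ⊴-refl

      p≢q : p ≢ q
      p≢q refl = p⋬q ⊴-refl

      cover : ∀ y → x ⊴ y → y ≡ x ⊎ p ⊴ y ⊎ q ⊴ y
      cover y l with y ≟ᶠ x
      ... | yes e = inj₁ e
      ... | no ne with minimal-below (λ y → x ⊴? y ×-dec ¬? (y ≟ᶠ x)) (l , ne)
      ... | r , r⊴y , (x⊴r , r≢x) , r-min with p ≟ᶠ r | q ≟ᶠ r
      ... | yes refl | _ = inj₂ (inj₁ r⊴y)
      ... | no _ | yes refl = inj₂ (inj₂ r⊴y)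
      ... | no p≢r | no q≢r = ⊥-elim (d2 x p q r x⊴p x⊴q x⊴r p≢q p≢r q≢r
        ( (p⋬q , q⋬p)
        , ((λ l → p≢r (r-min p (x⊴p , p≢x) l)) , (λ l → p≢r (sym (p-min r (x⊴r , r≢x) l))))
        , ((λ l → q≢r (r-min q (x⊴q , q≢x) l)) , (λ l → q≢r (sym (q-min r (x⊴r , r≢x) l))))))

      W = λ z → p ⊴ z × q ⊴ z
      W? = λ z → p ⊴? z ×-dec q ⊴? z

      joint = minimal-below {W} W? (proj₂ (d3 x p q x⊴p x⊴q))
      t = proj₁ joint
      p⊴t = proj₁ (proj₁ (proj₂ (proj₂ joint)))
      q⊴t = proj₂ (proj₁ (proj₂ (proj₂ joint)))
      t-min = proj₂ (proj₂ (proj₂ joint))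

      t≢x : t ≢ x
      t≢x e = p≢x (⊴-antisym (subst (p ⊴_) e p⊴t) x⊴p)

      t-least : ∀ z → W z → t ⊴ z
      t-least z (p⊴z , q⊴z) =
        let (s , t⊴s , z⊴s) = d3 x t z (⊴-trans x⊴p p⊴t) (⊴-trans x⊴p p⊴z)
            -- (D4) interpolates a common upper bound below both `t` and `z`; minimality of `t`
            -- identifies it with `t`.
            (w , p⊴w , q⊴w , w⊴t , w⊴z) = d4 x p q t z s x⊴p x⊴q p⊴t p⊴z q⊴t q⊴z t⊴s z⊴s
        in subst (_⊴ z) (t-min w (p⊴w , q⊴w) w⊴t) w⊴z

      p-cover : ∀ y → p ⊴ y → y ≡ p ⊎ t ⊴ y
      p-cover y l with y ≟ᶠ p
      ... | yes e = inj₁ e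
      ... | no ne = inj₂ (t-least y (l , d1 x p q y x⊴p x⊴q (⊴-trans x⊴p l) p≢q (ne ∘ sym)
                      (λ { refl → p⋬q l }) (p⋬q , q⋬p) l))

      q-cover : ∀ y → q ⊴ y → y ≡ q ⊎ t ⊴ y
      q-cover y l with y ≟ᶠ q
      ... | yes e = inj₁ e
      ... | no ne = inj₂ (t-least y (d1 x q p y x⊴q x⊴p (⊴-trans x⊴q l) (p≢q ∘ sym) (ne ∘ sym)
                      (λ { refl → q⋬p l }) (q⋬p , p⋬q) l , l))

  module _ (ν : Valuation P) (n : ℕ) where

    bitsAt : Fin size → Vec Bool n
    bitsAt x = tab n (λ i → val ν i x)

    -- Given as a relation because it is itself the bisimulation between the poset and the codes.
    data Encodes : Fin size → Code n → Set where
      maximal : ∀ {x} → (∀ y → x ⊴ y → y ≡ x) → Encodes x (top (bitsAt x))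
      point   : ∀ {x t c} → x ⊴ t → (∀ y → x ⊴ y → y ≡ x ⊎ t ⊴ y) → Encodes t c → Encodes x (pt (bitsAt x) c)
      diamond : ∀ {x p q t c} → x ⊴ p → x ⊴ q → p ⊴ t → q ⊴ t →
        (∀ y → p ⊴ y → y ≡ p ⊎ t ⊴ y) → (∀ y → q ⊴ y → y ≡ q ⊎ t ⊴ y) →
        (∀ y → x ⊴ y → y ≡ x ⊎ p ⊴ y ⊎ q ⊴ y) → Encodes t c →
        Encodes x (dia (bitsAt x) (bitsAt p) (bitsAt q) c)

    encode : DiamondSystem P → ∀ x → ∃ (Encodes x)
    encode ds x = go x (po-noetherian isPartialOrder x)
      where
      go : ∀ x → Acc _ x → ∃ (Encodes x)
      go x (acc rs) with shape ds x
      ... | maximal f = _ , maximal f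
      ... | point t l ne f = _ , point l f (proj₂ (go t (rs (l , ne ∘ sym))))
      ... | diamond p q t xp xq pt′ qt′ ne f g h =
        _ , diamond xp xq pt′ qt′ f g h (proj₂ (go t (rs (⊴-trans xp pt′ , ne ∘ sym))))

    encodes-root : ∀ {x c} → Encodes x c → root c ≡ bitsAt x
    encodes-root (maximal _) = refl
    encodes-root (point _ _ _) = refl
    encodes-root (diamond _ _ _ _ _ _ _ _) = refl

    encodes-forth : ∀ {x y c} → Encodes x c → x ⊴ y → ∃ λ d → c ≼ d × Encodes y d
    encodes-forth {y = y} r@(maximal f) l with refl ← f y l = _ , here , r
    encodes-forth {y = y} r@(point _ f r₀) l with f y l
    ... | inj₁ refl = _ , here , r
    ... | inj₂ l′ = let (d , p , q) = encodes-forth r₀ l′ in d , up p , q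
    encodes-forth {y = y} r@(diamond xp xq pt′ qt′ f g h r₀) l with h y l
    ... | inj₁ refl = _ , here , r
    ... | inj₂ (inj₁ l′) with f y l′
    ...   | inj₁ refl = _ , left here , point pt′ f r₀
    ...   | inj₂ l″ = let (d , p , q) = encodes-forth r₀ l″ in d , left (up p) , q
    encodes-forth {y = y} r@(diamond xp xq pt′ qt′ f g h r₀) l | inj₂ (inj₂ l′) with g y l′
    ...   | inj₁ refl = _ , right here , point qt′ g r₀
    ...   | inj₂ l″ = let (d , p , q) = encodes-forth r₀ l″ in d , right (up p) , q

    encodes-back : ∀ {x c d} → Encodes x c → c ≼ d → ∃ λ y → x ⊴ y × Encodes y d
    encodes-back r here = _ , ⊴-refl , r
    encodes-back (point l f r) (up p) =
      let (y , l′ , s) = encodes-back r p in y , ⊴-trans l l′ , s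
    encodes-back (diamond xp _ pt′ _ f _ _ r) (left here) = _ , xp , point pt′ f r
    encodes-back (diamond xp _ pt′ _ _ _ _ r) (left (up p)) =
      let (y , l , s) = encodes-back r p in y , ⊴-trans xp (⊴-trans pt′ l) , s
    encodes-back (diamond _ xq _ qt′ _ g _ r) (right here) = _ , xq , point qt′ g r
    encodes-back (diamond _ xq _ qt′ _ _ _ r) (right (up p)) =
      let (y , l , s) = encodes-back r p in y , ⊴-trans xq (⊴-trans qt′ l) , s

    bitsAt-mono : ∀ {x y} → x ⊴ y → bitsAt x ⊑ bitsAt y
    bitsAt-mono {x} {y} l = ⊑-intro λ i p →
      let i<n = at-bound (bitsAt x) i p in
      trans (at-tab _ i<n) (upward ν i l (trans (sym (at-tab _ i<n)) p))

    encodes-persistent : ∀ {x c} → Encodes x c → Persistent c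
    encodes-persistent (maximal _) = _
    encodes-persistent (point l _ r) =
      subst (_ ⊑_) (sym (encodes-root r)) (bitsAt-mono l) , encodes-persistent r
    encodes-persistent (diamond xp xq pt′ qt′ _ _ _ r) =
      bitsAt-mono xp , bitsAt-mono xq , subst (_ ⊑_) (sym (encodes-root r)) (bitsAt-mono pt′) ,
      subst (_ ⊑_) (sym (encodes-root r)) (bitsAt-mono qt′) , encodes-persistent r

    encodes-forces : ∀ φ → AllVars (_< n) φ → ∀ {x c} → Encodes x c →
      Kripke._⊩_ _⊴_ (λ x i → val ν i x ≡ true) x φ ⟷ c ⊩ φ
    encodes-forces φ p = bisimulation _⊴_ _ _≼_ atom (_< n) Encodes
      (λ {x} i i<n r → ≡⇒⟷ (cong (_≡ true)
        (trans (sym (at-tab _ i<n)) (cong (λ v → at v i) (sym (encodes-root r))))))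
      encodes-forth encodes-back φ p

  ∈⟦⟧⟷⊩ : ∀ ν φ {x} → _,_∈⟦_⟧ P ν x φ ⟷ Kripke._⊩_ _⊴_ (λ x i → val ν i x ≡ true) x φ
  ∈⟦⟧⟷⊩ ν (var _) = id , id
  ∈⟦⟧⟷⊩ ν ⊥' = id , id
  ∈⟦⟧⟷⊩ ν (φ ∧ ψ) =
    (λ (p , q) → proj₁ (∈⟦⟧⟷⊩ ν φ) p , proj₁ (∈⟦⟧⟷⊩ ν ψ) q) ,
    (λ (p , q) → proj₂ (∈⟦⟧⟷⊩ ν φ) p , proj₂ (∈⟦⟧⟷⊩ ν ψ) q)
  ∈⟦⟧⟷⊩ ν (φ ∨ ψ) =
    (λ { (inj₁ p) → inj₁ (proj₁ (∈⟦⟧⟷⊩ ν φ) p) ; (inj₂ p) → inj₂ (proj₁ (∈⟦⟧⟷⊩ ν ψ) p) }) ,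
    (λ { (inj₁ p) → inj₁ (proj₂ (∈⟦⟧⟷⊩ ν φ) p) ; (inj₂ p) → inj₂ (proj₂ (∈⟦⟧⟷⊩ ν ψ) p) })
  ∈⟦⟧⟷⊩ ν (φ ⇒ ψ) =
    (λ h y l p → proj₁ (∈⟦⟧⟷⊩ ν ψ) (h y l (proj₂ (∈⟦⟧⟷⊩ ν φ) p))) ,
    (λ h y l p → proj₂ (∈⟦⟧⟷⊩ ν ψ) (h y l (proj₁ (∈⟦⟧⟷⊩ ν φ) p)))

full : ∀ n → Vec Bool n
full n = tab n (λ _ → true)

at-full : ∀ {n i} → i < n → at (full n) i ≡ true
at-full = at-tab _

allVars-map : ∀ {P Q : ℕ → Set} → (∀ i → P i → Q i) → ∀ φ → AllVars P φ → AllVars Q φ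
allVars-map f (var i) p = f i p
allVars-map f ⊥' _ = tt
allVars-map f (φ ∧ ψ) (p , q) = allVars-map f φ p , allVars-map f ψ q
allVars-map f (φ ∨ ψ) (p , q) = allVars-map f φ p , allVars-map f ψ q
allVars-map f (φ ⇒ ψ) (p , q) = allVars-map f φ p , allVars-map f ψ q

-- Every point of a finite diamond sequence is bisimilar, over the first n variables, to a reduced
-- code. From here on, validity is only tested in reduced codes.
validDHA : ∀ φ → AllVars (_< n) φ → (∀ (c : Code n) → Reduced (full n) c → c ⊩ φ) → ValidDHA φ
validDHA {n} φ p h P (ds , _) ν x =
  let (c , r) = encode P ν n ds x in
  proj₂ (∈⟦⟧⟷⊩ P ν φ) (proj₂ (encodes-forces P ν n φ p r)
    (proj₂ (reduce-forces (full n) φ (allVars-map (λ _ → at-full) φ p))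
      (h _ (reduce-reduced (full n) c (encodes-persistent P ν n r)))))

-- Finite conjunctions and disjunctions

⊤' : Formula
⊤' = ⊥' ⇒ ⊥'

⋀ : List Formula → Formula
⋀ [] = ⊤'
⋀ (φ ∷ Γ) = φ ∧ ⋀ Γ

⊩-⋀ : ∀ Γ → c ⊩ ⋀ Γ ⟷ (∀ {φ} → φ ∈ Γ → c ⊩ φ)
⊩-⋀ [] = (λ _ ()) , (λ _ _ _ ())
⊩-⋀ (φ ∷ Γ) =
  (λ { (p , q) (here refl) → p ; (p , q) (there l) → proj₁ (⊩-⋀ Γ) q l }) ,
  (λ h → h (here refl) , proj₂ (⊩-⋀ Γ) (h ∘ there))

module _ {A : Set} (t : A → Bool) (f : A → Formula) where

  -- Members rejected by `t` contribute `⊥'` instead of being dropped, so all disjunctions of this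
  -- form can be listed by the product in `joins`.
  join : List A → Formula
  join [] = ⊥'
  join (x ∷ xs) = (if t x then f x else ⊥') ∨ join xs

  ⊩-join : ∀ xs → c ⊩ join xs ⟷ (∃ λ x → x ∈ xs × t x ≡ true × c ⊩ f x)
  ⊩-join [] = (λ ()) , (λ { (_ , () , _) })
  ⊩-join {c = c} (x ∷ xs) = to , from
    where
    to : c ⊩ join (x ∷ xs) → _
    to (inj₁ p) with t x in eq
    ... | true = x , here refl , eq , p
    to (inj₂ p) = let (y , l , r) = proj₁ (⊩-join xs) p in y , there l , r
    from : _ → c ⊩ join (x ∷ xs)
    from (_ , here refl , e , p) rewrite e = inj₁ p
    from (y , there l , r) = inj₂ (proj₂ (⊩-join xs) (y , l , r))

  allVars-join : {P : ℕ → Set} → (∀ x → AllVars P (f x)) → ∀ xs → AllVars P (join xs)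
  allVars-join h [] = tt
  allVars-join {P} h (x ∷ xs) = go , allVars-join h xs
    where
    go : AllVars P (if t x then f x else ⊥')
    go with t x
    ... | true = h x
    ... | false = tt

⋀-below : (ℕ → Formula) → ℕ → Formula
⋀-below f zero = ⊤'
⋀-below f (suc k) = f k ∧ ⋀-below f k

⊩-⋀-below : ∀ f k → c ⊩ ⋀-below f k ⟷ (∀ i → i < k → c ⊩ f i)
⊩-⋀-below f zero = (λ _ _ ()) , (λ _ _ _ ())
⊩-⋀-below {c = c} f (suc k) = to , (λ h → h k (n<1+n k) , proj₂ (⊩-⋀-below f k) (λ i l → h i (m<n⇒m<1+n l)))
  where
  to : c ⊩ ⋀-below f (suc k) → ∀ i → i < suc k → c ⊩ f i
  to (p , q) i l with m<1+n⇒m<n∨m≡n l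
  ... | inj₁ l′ = proj₁ (⊩-⋀-below f k) q i l′
  ... | inj₂ refl = p

allVars-⋀-below : {P : ℕ → Set} {f : ℕ → Formula} → (∀ i → AllVars P (f i)) → ∀ k → AllVars P (⋀-below f k)
allVars-⋀-below h zero = tt , tt
allVars-⋀-below h (suc k) = h k , allVars-⋀-below h k

≼-induction : (P : Code n → Set) → (∀ c → (∀ d → c ≼ d → d ≢ c → P d) → P c) → ∀ c → P c
≼-induction P step c = go c (<-wellFounded (rank c))
  where
  go : ∀ c → Acc _<_ (rank c) → P c
  go c (acc rs) = step c below
    where
    below : ∀ d → c ≼ d → d ≢ c → P d
    below d l ne with ≼-rank l
    ... | inj₁ refl = ⊥-elim (ne refl)
    ... | inj₂ q = go d (rs q)

-- Definability of principal upsets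

module Characteristic {n : ℕ} (m : Vec Bool n) where

  -- Here ψ defines the points strictly above the intended one. A variable absent from `v` may
  -- become true only there, so where ψ fails the literals determine the root over `m`.
  literal : Vec Bool n → Formula → ℕ → Formula
  literal v ψ i = if at m i then (if at v i then var i else var i ⇒ ψ) else ⊤'

  literals : Vec Bool n → Formula → Formula
  literals v ψ = ⋀-below (literal v ψ) n

  -- The second conjunct says that a point outside the upset defined by φ sees the least point of
  -- that upset: otherwise φ could only hold strictly above that least point, so `φ ⇒ φ⁺` would hold
  -- and yield φ.
  characteristic-pt : Vec Bool n → Formula → Formula → Formula
  characteristic-pt v φ φ⁺ = literals v φ ∧ ((φ ⇒ φ⁺) ⇒ φ)

  -- A variant of the de Jongh formulas: characteristic b holds at c iff b ≼ c, and
  -- characteristic⁺ b holds at c iff c lies strictly above b.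
  mutual
    characteristic : Code n → Formula
    characteristic (top v) = literals v ⊥'
    characteristic (pt v c) = characteristic-pt v (characteristic c) (characteristic⁺ c)
    characteristic (dia v w₁ w₂ c) = literals v (φ₁ ∨ φ₂)
      -- The same device for each middle point, whose strict upper part is the upset of `c`. The
      -- formulas of the middle points are unfolded to keep the recursion structural.
      ∧ ((φ₁ ⇒ characteristic c) ⇒ φ₁ ∨ φ₂) ∧ ((φ₂ ⇒ characteristic c) ⇒ φ₁ ∨ φ₂)
      where
      φ₁ = characteristic-pt w₁ (characteristic c) (characteristic⁺ c)
      φ₂ = characteristic-pt w₂ (characteristic c) (characteristic⁺ c)

    characteristic⁺ : Code n → Formula
    characteristic⁺ (top v) = ⊥'
    characteristic⁺ (pt v c) = characteristic c
    characteristic⁺ (dia v w₁ w₂ c) =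
      characteristic-pt w₁ (characteristic c) (characteristic⁺ c)
      ∨ characteristic-pt w₂ (characteristic c) (characteristic⁺ c)

  Masked : Formula → Set
  Masked = AllVars (λ i → at m i ≡ true)

  masked-literals : ∀ v {ψ} → Masked ψ → Masked (literals v ψ)
  masked-literals v {ψ} p = allVars-⋀-below go n
    where
    go : ∀ i → Masked (literal v ψ i)
    go i with at m i in eq
    ... | false = tt , tt
    ... | true with at v i
    ...   | true = eq
    ...   | false = eq , p

  masked-pt : ∀ v φ ψ → Masked φ → Masked ψ → Masked (characteristic-pt v φ ψ)
  masked-pt v φ ψ p q = masked-literals v p , (p , q) , p

  masked : ∀ c → Masked (characteristic c)
  masked⁺ : ∀ c → Masked (characteristic⁺ c)
  masked (top v) = masked-literals v tt
  masked (pt v c) = masked-pt v _ (characteristic⁺ c) (masked c) (masked⁺ c)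
  masked (dia v w₁ w₂ c) =
    masked-literals v q , ((masked-pt w₁ _ (characteristic⁺ c) p p⁺ , p) , q) ,
    ((masked-pt w₂ _ (characteristic⁺ c) p p⁺ , p) , q)
    where
    p = masked c
    p⁺ = masked⁺ c
    q = masked-pt w₁ _ (characteristic⁺ c) p p⁺ , masked-pt w₂ _ (characteristic⁺ c) p p⁺
  masked⁺ (top v) = tt
  masked⁺ (pt v c) = masked c
  masked⁺ (dia v w₁ w₂ c) =
    masked-pt w₁ _ (characteristic⁺ c) (masked c) (masked⁺ c) ,
    masked-pt w₂ _ (characteristic⁺ c) (masked c) (masked⁺ c)

  root-literals : ∀ {c v ψ} → Reduced m c → v ⊑ m → c ⊩ literals v ψ → ¬ (c ⊩ ψ) → root c ≡ v
  root-literals {c} {v} {ψ} r s p np = ⊑-antisym (⊑-intro below) (⊑-intro above)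
    where
    lit : ∀ i → at m i ≡ true → c ⊩ literal v ψ i
    lit i e = proj₁ (⊩-⋀-below (literal v ψ) n) p i (at-bound m i e)

    above : ∀ i → at v i ≡ true → at (root c) i ≡ true
    above i e with e′ ← ⊑-at s i e with l ← lit i e′ rewrite e′ | e = l

    below : ∀ i → at (root c) i ≡ true → at v i ≡ true
    below i e with e′ ← ⊑-at (reduced-root c r) i e with l ← lit i e′ rewrite e′ with at v i
    ... | true = refl
    ... | false = ⊥-elim (np (l c here e))

  literals-intro : ∀ {c v ψ} → Persistent c → root c ≡ v → (∀ d → c ≼ d → d ≡ c ⊎ d ⊩ ψ) → c ⊩ literals v ψ
  literals-intro {c} {v} {ψ} p refl h = proj₂ (⊩-⋀-below (literal v ψ) n) λ i _ → go i
    where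
    go : ∀ i → c ⊩ literal v ψ i
    go i with at m i
    ... | false = λ _ _ ()
    ... | true with at v i in eq
    ...   | true = eq
    ...   | false = new
      where
      new : ∀ d → c ≼ d → at (root d) i ≡ true → d ⊩ ψ
      new d l e with h d l
      ... | inj₂ q = q
      ... | inj₁ refl with () ← trans (sym eq) e

  Correct : Code n → Set
  Correct b = ∀ c → Reduced m c → c ⊩ characteristic b ⟷ b ≼ c

  Correct⁺ : Code n → Set
  Correct⁺ b = ∀ c → Reduced m c → c ⊩ characteristic⁺ b ⟷ (b ≼ c × c ≢ b)

  -- Induction from the top: by persistence the formula also holds strictly above `c`, so everything
  -- there may be assumed to lie above `b`. It remains to exclude a new point underneath.
  correct-intro : ∀ b → Reduced m b → b ⊩ characteristic b →
    (∀ c → Reduced m c → (∀ d → c ≼ d → d ≢ c → b ≼ d) → c ⊩ characteristic b → b ≼ c) → Correct b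
  correct-intro b r p h c s = ≼-induction (λ c → Reduced m c → c ⊩ characteristic b → b ≼ c)
      (λ c ih s q → h c s (λ d l ne → ih d l ne (reduced-≼ s l)
        (persistence (reduced⇒persistent c s) (characteristic b) l q)) q) c s ,
    λ l → persistence (reduced⇒persistent b r) (characteristic b) l p

  correct-top : Reduced m (top v) → Correct (top v)
  correct-top {v} r = correct-intro _ r
    (literals-intro tt refl λ { _ here → inj₁ refl }) λ c s above p → go c s above (root-literals s r p (λ ()))
    where
    go : ∀ c → Reduced m c → (∀ d → c ≼ d → d ≢ c → top v ≼ d) → root c ≡ v → top v ≼ c
    go (top _) _ _ refl = here
    go (pt _ c) (_ , ne , _) h refl with here ← h c (up here) (λ ()) = ⊥-elim (ne refl)
    go (dia _ w₁ _ c) _ h _ with () ← h (pt w₁ c) (left here) (λ ())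

  -- The immediate successor of a `pt` is squeezed onto `d`, as reducedness forbids it to repeat
  -- `v`. A diamond is impossible: its two incomparable middle points cannot both lie above `pt v d`
  -- while one of them lies below `d`.
  only-pt : Reduced m c → root c ≡ v → c ≼ d → c ≢ d → (∀ e → c ≼ e → e ≢ c → pt v d ≼ e) → pt v d ≼ c
  only-pt r e here ne h = ⊥-elim (ne refl)
  only-pt {c = pt _ c} (_ , ne , _) refl (up l) _ h with h c (up here) (λ ())
  ... | here = ⊥-elim (ne refl)
  ... | up l′ with refl ← ≼-antisym l l′ = here
  only-pt {c = dia _ w₁ w₂ c} (_ , _ , w₁<w₂ , _) refl (left l) _ h
    with h (pt w₁ c) (left here) (λ ()) | h (pt w₂ c) (right here) (λ ())
  ... | here | here = ⊥-elim (<ᵥ-asym w₁<w₂ w₁<w₂)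
  ... | here | up q = ⊥-elim (pt-irrefl q)
  ... | up p | q with refl ← ≼-antisym l p with q
  ...   | up q′ with refl ← pt≼pt q′ = ⊥-elim (<ᵥ-asym w₁<w₂ w₁<w₂)
  only-pt {c = dia _ w₁ w₂ c} (_ , _ , w₁<w₂ , _) refl (right l) _ h
    with h (pt w₂ c) (right here) (λ ()) | h (pt w₁ c) (left here) (λ ())
  ... | here | here = ⊥-elim (<ᵥ-asym w₁<w₂ w₁<w₂)
  ... | here | up q = ⊥-elim (pt-irrefl q)
  ... | up p | q with refl ← ≼-antisym l p with q
  ...   | up q′ with refl ← pt≼pt q′ = ⊥-elim (<ᵥ-asym w₁<w₂ w₁<w₂)

  correct-pt : ∀ v c → Correct c → Correct⁺ c → Reduced m (pt v c) → Correct (pt v c)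
  correct-pt v c cor cor⁺ r@(s , ne , r₀) = correct-intro _ r (lits , jump) elim
    where
    lits : pt v c ⊩ literals v (characteristic c)
    lits = literals-intro (reduced⇒persistent (pt v c) r) refl λ
      { _ here → inj₁ refl
      ; d (up l) → inj₂ (proj₂ (cor d (reduced-≼ r₀ l)) l) }

    jump : pt v c ⊩ (characteristic c ⇒ characteristic⁺ c) ⇒ characteristic c
    jump _ here p = ⊥-elim (proj₂ (proj₁ (cor⁺ c r₀) (p c (up here) (proj₂ (cor c r₀) here))) refl)
    jump d (up l) _ = proj₂ (cor d (reduced-≼ r₀ l)) l

    elim : ∀ d → Reduced m d → (∀ e → d ≼ e → e ≢ d → pt v c ≼ e) → d ⊩ characteristic (pt v c) → pt v c ≼ d
    elim d s′ h (p , q) with c ≼? d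
    ... | yes l = up l
    ... | no nl with d ≼? c
    ...   | no nl′ = ⊥-elim (nl (proj₁ (cor d s′) (q d here λ e l x →
              proj₂ (cor⁺ e (reduced-≼ s′ l)) (proj₁ (cor e (reduced-≼ s′ l)) x , λ { refl → nl′ l }))))
    ...   | yes l = only-pt s′ (root-literals s′ (reduced-root (pt v c) r) p (nl ∘ proj₁ (cor d s′))) l
              (λ { refl → nl here }) h

  -- An immediate successor of `c` below both middle points would have to be the root of the
  -- diamond, which is excluded. So `c` branches, and its own middle points are the given ones.
  only-dia : w₁ <ᵥ w₂ → Reduced m c → root c ≡ v → c ≼ pt w₁ d → c ≼ pt w₂ d →
    ¬ pt w₁ d ≼ c → ¬ pt w₂ d ≼ c → (∀ e → c ≼ e → e ≢ c → dia v w₁ w₂ d ≼ e) → dia v w₁ w₂ d ≼ c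
  only-dia o r e here l₂ n₁ n₂ h = ⊥-elim (n₁ here)
  only-dia o r e (up l₁) here n₁ n₂ h = ⊥-elim (n₂ here)
  only-dia {c = pt _ c} o (_ , ne , _) refl (up l₁) (up l₂) n₁ n₂ h with h c (up here) (λ ())
  ... | here = ⊥-elim (ne refl)
  ... | left l with refl ← pt≼pt (≼-trans l l₂) = ⊥-elim (<ᵥ-asym o o)
  ... | right l with refl ← pt≼pt (≼-trans l l₁) = ⊥-elim (<ᵥ-asym o o)
  only-dia {c = dia _ u₁ u₂ c} o r refl (left l₁) (left l₂) n₁ n₂ h with h (pt u₁ c) (left here) (λ ())
  ... | left l with refl ← pt≼pt (≼-trans l l₂) = ⊥-elim (<ᵥ-asym o o)
  ... | right l with refl ← pt≼pt (≼-trans l l₁) = ⊥-elim (<ᵥ-asym o o)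
  only-dia {c = dia _ u₁ u₂ c} o r refl (right l₁) (right l₂) n₁ n₂ h with h (pt u₂ c) (right here) (λ ())
  ... | left l with refl ← pt≼pt (≼-trans l l₂) = ⊥-elim (<ᵥ-asym o o)
  ... | right l with refl ← pt≼pt (≼-trans l l₁) = ⊥-elim (<ᵥ-asym o o)
  only-dia {c = dia _ u₁ u₂ c} o r refl (left l₁) (right l₂) n₁ n₂ h
    with h (pt u₁ c) (left here) (λ ()) | h (pt u₂ c) (right here) (λ ())
  ... | right l | _ with refl ← pt≼pt (≼-trans l l₁) = ⊥-elim (<ᵥ-asym o o)
  ... | left _ | left l with refl ← pt≼pt (≼-trans l l₂) = ⊥-elim (<ᵥ-asym o o)
  ... | left l | right l′ with refl ← ≼-antisym l l₁ | refl ← ≼-antisym l′ l₂ = here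
  only-dia {c = dia _ u₁ u₂ c} o (_ , _ , o′ , _) refl (right l₁) (left l₂) n₁ n₂ h
    with h (pt u₁ c) (left here) (λ ()) | h (pt u₂ c) (right here) (λ ())
  ... | left l | _ with refl ← pt≼pt (≼-trans l l₂) = ⊥-elim (<ᵥ-asym o o)
  ... | right _ | right l with refl ← pt≼pt (≼-trans l l₁) = ⊥-elim (<ᵥ-asym o o)
  -- The mirror image of the diamond is ruled out by the order of its middle points.
  ... | right l | left l′ with refl ← ≼-antisym l l₂ | refl ← ≼-antisym l′ l₁ = ⊥-elim (<ᵥ-asym o o′)

  correct-dia : ∀ v w₁ w₂ c → Correct c → Correct (pt w₁ c) → Correct (pt w₂ c) →
    Reduced m (dia v w₁ w₂ c) → Correct (dia v w₁ w₂ c)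
  correct-dia v w₁ w₂ c cor cor₁ cor₂ r@(s₁ , s₂ , o , r₁ , r₂ , r₀) =
    correct-intro _ r (lits , jump₁ , jump₂) elim
    where
    b₁ = pt w₁ c
    b₂ = pt w₂ c

    red₁ : Reduced m b₁
    red₁ = proj₁ r₁ , proj₂ r₁ , r₀

    red₂ : Reduced m b₂
    red₂ = proj₁ r₂ , proj₂ r₂ , r₀

    either : ∀ d → Reduced m d → d ⊩ characteristic b₁ ∨ characteristic b₂ ⟷ (b₁ ≼ d ⊎ b₂ ≼ d)
    either d s =
      (λ { (inj₁ p) → inj₁ (proj₁ (cor₁ d s) p) ; (inj₂ p) → inj₂ (proj₁ (cor₂ d s) p) }) ,
      (λ { (inj₁ p) → inj₁ (proj₂ (cor₁ d s) p) ; (inj₂ p) → inj₂ (proj₂ (cor₂ d s) p) })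

    lits : dia v w₁ w₂ c ⊩ literals v (characteristic b₁ ∨ characteristic b₂)
    lits = literals-intro (reduced⇒persistent (dia v w₁ w₂ c) r) refl λ
      { _ here → inj₁ refl
      ; d (left l) → inj₂ (proj₂ (either d (reduced-≼ red₁ l)) (inj₁ l))
      ; d (right l) → inj₂ (proj₂ (either d (reduced-≼ red₂ l)) (inj₂ l)) }

    jump₁ : dia v w₁ w₂ c ⊩ (characteristic b₁ ⇒ characteristic c) ⇒ characteristic b₁ ∨ characteristic b₂
    jump₁ _ here p = ⊥-elim (pt-irrefl (proj₁ (cor b₁ red₁) (p b₁ (left here) (proj₂ (cor₁ b₁ red₁) here))))
    jump₁ d (left l) _ = proj₂ (either d (reduced-≼ red₁ l)) (inj₁ l)
    jump₁ d (right l) _ = proj₂ (either d (reduced-≼ red₂ l)) (inj₂ l)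

    jump₂ : dia v w₁ w₂ c ⊩ (characteristic b₂ ⇒ characteristic c) ⇒ characteristic b₁ ∨ characteristic b₂
    jump₂ _ here p = ⊥-elim (pt-irrefl (proj₁ (cor b₂ red₂) (p b₂ (right here) (proj₂ (cor₂ b₂ red₂) here))))
    jump₂ d (left l) _ = proj₂ (either d (reduced-≼ red₁ l)) (inj₁ l)
    jump₂ d (right l) _ = proj₂ (either d (reduced-≼ red₂ l)) (inj₂ l)

    elim : ∀ d → Reduced m d → (∀ e → d ≼ e → e ≢ d → dia v w₁ w₂ c ≼ e) →
      d ⊩ characteristic (dia v w₁ w₂ c) → dia v w₁ w₂ c ≼ d
    elim d s h (p , q₁ , q₂) with b₁ ≼? d | b₂ ≼? d
    ... | yes l | _ = left l
    ... | no _ | yes l = right l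
    ... | no n₁ | no n₂ =
      only-dia o s (root-literals s (reduced-root (dia v w₁ w₂ c) r) p none) below₁ below₂ n₁ n₂ h
      where
      none : ¬ (d ⊩ characteristic b₁ ∨ characteristic b₂)
      none x with proj₁ (either d s) x
      ... | inj₁ l = n₁ l
      ... | inj₂ l = n₂ l

      below₁ : d ≼ b₁
      below₁ with d ≼? b₁
      ... | yes l = l
      ... | no nl = ⊥-elim (none (q₁ d here λ e l x → proj₂ (cor e (reduced-≼ s l))
              (strict e l (proj₁ (cor₁ e (reduced-≼ s l)) x))))
        where
        strict : ∀ e → d ≼ e → b₁ ≼ e → c ≼ e
        strict _ l here = ⊥-elim (nl l)
        strict _ _ (up l) = l

      below₂ : d ≼ b₂
      below₂ with d ≼? b₂
      ... | yes l = l
      ... | no nl = ⊥-elim (none (q₂ d here λ e l x → proj₂ (cor e (reduced-≼ s l))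
              (strict e l (proj₁ (cor₂ e (reduced-≼ s l)) x))))
        where
        strict : ∀ e → d ≼ e → b₂ ≼ e → c ≼ e
        strict _ l here = ⊥-elim (nl l)
        strict _ _ (up l) = l

  correct : ∀ b → Reduced m b → Correct b
  correct⁺ : ∀ b → Reduced m b → Correct⁺ b
  correct (top v) r = correct-top r
  correct (pt v c) r@(_ , _ , r₀) = correct-pt v c (correct c r₀) (correct⁺ c r₀) r
  correct (dia v w₁ w₂ c) r@(_ , _ , _ , (x , y) , (z , u) , r₀) =
    correct-dia v w₁ w₂ c (correct c r₀)
      (correct-pt w₁ c (correct c r₀) (correct⁺ c r₀) (x , y , r₀))
      (correct-pt w₂ c (correct c r₀) (correct⁺ c r₀) (z , u , r₀)) r
  correct⁺ (top v) r c s = (λ ()) , λ { (here , ne) → ne refl }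
  correct⁺ (pt v b) (_ , _ , r₀) c s =
    (λ p → let l = proj₁ (correct b r₀ c s) p in up l , λ { refl → pt-irrefl l }) ,
    λ { (here , ne) → ⊥-elim (ne refl) ; (up l , _) → proj₂ (correct b r₀ c s) l }
  correct⁺ (dia v w₁ w₂ b) (_ , _ , _ , (x , y) , (z , u) , r₀) c s =
    (λ { (inj₁ p) → let l = proj₁ (cor₁ c s) p in left l , λ { refl → no-loop l }
       ; (inj₂ p) → let l = proj₁ (cor₂ c s) p in right l , λ { refl → no-loop l } }) ,
    λ { (here , ne) → ⊥-elim (ne refl)
      ; (left l , _) → inj₁ (proj₂ (cor₁ c s) l)
      ; (right l , _) → inj₂ (proj₂ (cor₂ c s) l) }
    where
    cor₁ = correct-pt w₁ b (correct b r₀) (correct⁺ b r₀) (x , y , r₀)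
    cor₂ = correct-pt w₂ b (correct b r₀) (correct⁺ b r₀) (z , u , r₀)

    no-loop : ∀ {v w w₁ w₂} {b : Code n} → ¬ pt w b ≼ dia v w₁ w₂ b
    no-loop (up l) with () ← ≼-antisym l (left (up here))

-- Decidability of reducedness and bounds on variables

_⊑?_ : (v w : Vec Bool n) → Dec (v ⊑ w)
[] ⊑? [] = yes ⊑-refl
(true ∷ v) ⊑? (false ∷ w) = no λ p → case-false (⊑-at p 0 refl)
  where
  case-false : ¬ (false ≡ true)
  case-false ()
(false ∷ v) ⊑? (b ∷ w) = map′ (λ p → ⊑-intro λ { (suc i) → ⊑-at p i }) (λ p → ⊑-intro (⊑-at p ∘ suc)) (v ⊑? w)
(true ∷ v) ⊑? (true ∷ w) =
  map′ (λ p → ⊑-intro λ { zero _ → refl ; (suc i) → ⊑-at p i }) (λ p → ⊑-intro (⊑-at p ∘ suc)) (v ⊑? w)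

_<ᵥ?_ : (v w : Vec Bool n) → Dec (v <ᵥ w)
v <ᵥ? w with <ᵥ-cmp v w
... | inj₁ p = yes p
... | inj₂ (inj₁ refl) = no λ p → <ᵥ-asym p p
... | inj₂ (inj₂ p) = no (<ᵥ-asym p)

reduced? : (m : Vec Bool n) (c : Code n) → Dec (Reduced m c)
reduced? m (top v) = v ⊑? m
reduced? m (pt v c) = v ⊑? root c ×-dec ¬? (v ≟ᵥ root c) ×-dec reduced? m c
reduced? m (dia v w₁ w₂ c) = v ⊑? w₁ ×-dec v ⊑? w₂ ×-dec w₁ <ᵥ? w₂
  ×-dec (w₁ ⊑? root c ×-dec ¬? (w₁ ≟ᵥ root c)) ×-dec (w₂ ⊑? root c ×-dec ¬? (w₂ ≟ᵥ root c)) ×-dec reduced? m c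

bound : Formula → ℕ
bound (var i) = suc i
bound ⊥' = 0
bound (φ ∧ ψ) = bound φ ⊔ bound ψ
bound (φ ∨ ψ) = bound φ ⊔ bound ψ
bound (φ ⇒ ψ) = bound φ ⊔ bound ψ

allVars-bound : ∀ φ {k} → bound φ ≤ k → AllVars (_< k) φ
allVars-bound (var i) p = p
allVars-bound ⊥' p = tt
allVars-bound (φ ∧ ψ) p =
  allVars-bound φ (≤-trans (m≤m⊔n _ _) p) , allVars-bound ψ (≤-trans (m≤n⊔m (bound φ) _) p)
allVars-bound (φ ∨ ψ) p =
  allVars-bound φ (≤-trans (m≤m⊔n _ _) p) , allVars-bound ψ (≤-trans (m≤n⊔m (bound φ) _) p)
allVars-bound (φ ⇒ ψ) p =
  allVars-bound φ (≤-trans (m≤m⊔n _ _) p) , allVars-bound ψ (≤-trans (m≤n⊔m (bound φ) _) p)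

allVars-⋀ : {P : ℕ → Set} → ∀ Γ → (∀ {φ} → φ ∈ Γ → AllVars P φ) → AllVars P (⋀ Γ)
allVars-⋀ [] h = tt , tt
allVars-⋀ (φ ∷ Γ) h = h (here refl) , allVars-⋀ Γ (h ∘ there)

bound-⋀ : ∀ Γ {φ} → φ ∈ Γ → bound φ ≤ bound (⋀ Γ)
bound-⋀ (φ ∷ Γ) (here refl) = m≤m⊔n _ _
bound-⋀ (φ ∷ Γ) (there l) = ≤-trans (bound-⋀ Γ l) (m≤n⊔m (bound φ) _)

allVars-sub : {P Q : ℕ → Set} {σ : Subst} → (∀ i → P i → AllVars Q (σ i)) → ∀ φ → AllVars P φ → AllVars Q (sub σ φ)
allVars-sub h (var i) p = h i p
allVars-sub h ⊥' _ = tt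
allVars-sub h (φ ∧ ψ) (p , q) = allVars-sub h φ p , allVars-sub h ψ q
allVars-sub h (φ ∨ ψ) (p , q) = allVars-sub h φ p , allVars-sub h ψ q
allVars-sub h (φ ⇒ ψ) (p , q) = allVars-sub h φ p , allVars-sub h ψ q

-- Structural completeness

module Retraction {n : ℕ} where

  open Characteristic (full n)

  masked⇒bounded : ∀ φ → Masked φ → AllVars (_< n) φ
  masked⇒bounded = allVars-map (at-bound (full n))

  -- Semantically a p-morphism from all models onto the upset of x which fixes that upset.
  retract : Code n → Subst
  retract x i = join (λ b → at (root b) i) (λ b → characteristic x ⇒ characteristic b) (ups x)

  retract-bounded : ∀ x i → AllVars (_< n) (retract x i)
  retract-bounded x i = allVars-join (λ b → at (root b) i) _
    (λ b → masked⇒bounded (characteristic x) (masked x) , masked⇒bounded (characteristic b) (masked b)) (ups x)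

  module _ (x : Code n) (rx : Reduced (full n) x) where

    Sees : Code n → Code n → Set
    Sees c b = ∀ e → c ≼ e → x ≼ e → b ≼ e

    retract-forces : Reduced (full n) c → ∀ i →
      c ⊩ retract x i ⟷ (∃ λ b → x ≼ b × atom b i × Sees c b)
    retract-forces {c} r i = to , from
      where
      to : c ⊩ retract x i → _
      to p =
        let (b , l , t , q) = proj₁ (⊩-join _ _ (ups x)) p
            x≼b = ∈ups⇒≼ l in
        b , x≼b , t , λ e k x≼e → let r′ = reduced-≼ r k in
          proj₁ (correct b (reduced-≼ rx x≼b) e r′) (q e k (proj₂ (correct x rx e r′) x≼e))
      from : _ → c ⊩ retract x i
      from (b , x≼b , t , s) = proj₂ (⊩-join _ _ (ups x)) (b , ≼⇒∈ups x≼b , t , λ e k p →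
        let r′ = reduced-≼ r k in
        proj₂ (correct b (reduced-≼ rx x≼b) e r′) (s e k (proj₁ (correct x rx e r′) p)))

    -- ImageOf c d says that the p-morphism onto the upset of x maps c to d.
    data ImageOf : Code n → Code n → Set where
      inside : x ≼ c → ImageOf c c
      above  : ¬ x ≼ pt v c → ImageOf c d → ImageOf (pt v c) d
      -- Within the upset of `x`, `d` is the meet of `d₁` and `d₂`, as `image-sees` needs; and `d`
      -- sees nothing besides itself and their upsets, as `image-back` needs.
      merge  : ∀ {d₁ d₂} → ¬ x ≼ dia v w₁ w₂ c → ImageOf (pt w₁ c) d₁ → ImageOf (pt w₂ c) d₂ →
        x ≼ d → d ≼ d₁ → d ≼ d₂ → (∀ e → d ≼ e → e ≡ d ⊎ d₁ ≼ e ⊎ d₂ ≼ e) →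
        (∀ b → x ≼ b → b ≼ d₁ → b ≼ d₂ → b ≼ d) → ImageOf (dia v w₁ w₂ c) d

    image-inside : ImageOf c d → x ≼ d
    image-inside (inside l) = l
    image-inside (above _ p) = image-inside p
    image-inside (merge _ _ _ l _ _ _ _) = l

    image-forth : ImageOf c d → c ≼ e → ∃ λ d′ → d ≼ d′ × ImageOf e d′
    image-forth (inside l) k = _ , k , inside (≼-trans l k)
    image-forth p@(above _ _) here = _ , here , p
    image-forth (above _ p) (up k) = image-forth p k
    image-forth p@(merge _ _ _ _ _ _ _ _) here = _ , here , p
    image-forth (merge _ p _ _ l _ _ _) (left k) = let (d′ , l′ , q) = image-forth p k in d′ , ≼-trans l l′ , q
    image-forth (merge _ _ p _ _ l _ _) (right k) = let (d′ , l′ , q) = image-forth p k in d′ , ≼-trans l l′ , q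

    image-back : ImageOf c d → d ≼ e → ∃ λ c′ → c ≼ c′ × ImageOf c′ e
    image-back (inside l) k = _ , k , inside (≼-trans l k)
    image-back (above _ p) k = let (c′ , l , q) = image-back p k in c′ , up l , q
    image-back p@(merge _ p₁ p₂ _ _ _ h _) k with h _ k
    ... | inj₁ refl = _ , here , p
    ... | inj₂ (inj₁ k′) = let (c′ , l , q) = image-back p₁ k′ in c′ , left l , q
    ... | inj₂ (inj₂ k′) = let (c′ , l , q) = image-back p₂ k′ in c′ , right l , q

    -- This links the formula to the map: the disjuncts of `retract x i` that hold at `c` come from
    -- points below the image of `c`, and by persistence such a disjunct exists exactly when `i` is
    -- true at that image.
    image-sees : ImageOf c d → x ≼ b → Sees c b ⟷ b ≼ d
    image-sees (inside l) _ = (λ s → s _ here l) , λ k e l′ _ → ≼-trans k l′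
    image-sees (above nl p) y =
      (λ s → proj₁ (image-sees p y) λ e l → s e (up l)) ,
      λ k → λ { _ here l → ⊥-elim (nl l) ; e (up l) → proj₂ (image-sees p y) k e l }
    image-sees (merge nl p₁ p₂ _ l₁ l₂ _ h) y =
      (λ s → h _ y (proj₁ (image-sees p₁ y) λ e l → s e (left l)) (proj₁ (image-sees p₂ y) λ e l → s e (right l))) ,
      λ k → λ
        { _ here l → ⊥-elim (nl l)
        ; e (left l) → proj₂ (image-sees p₁ y) (≼-trans k l₁) e l
        ; e (right l) → proj₂ (image-sees p₂ y) (≼-trans k l₂) e l }

    -- By `≼-linear` the images of the two middle points are comparable, and the lower one serves,
    -- or they are siblings, and the root of their diamond serves.
    image-join : ∀ {d₁ d₂} → ¬ x ≼ dia v w₁ w₂ c → ImageOf (pt w₁ c) d₁ → ImageOf (pt w₂ c) d₂ →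
      ∃ (ImageOf (dia v w₁ w₂ c))
    image-join nl p₁ p₂ with ≼-linear (image-inside p₁) (image-inside p₂)
    ... | inj₁ l = _ , merge nl p₁ p₂ (image-inside p₁) here l (λ e k → inj₂ (inj₁ k)) (λ _ _ k _ → k)
    ... | inj₂ (inj₁ l) = _ , merge nl p₁ p₂ (image-inside p₂) l here (λ e k → inj₂ (inj₂ k)) (λ _ _ _ k → k)
    ... | inj₂ (inj₂ (u , u₁ , u₂ , t , x≼z , s)) = z , go s p₁ p₂
      where
      z = dia u u₁ u₂ t

      incomparable : ¬ pt u₁ t ≼ pt u₂ t × ¬ pt u₂ t ≼ pt u₁ t
      incomparable with (_ , _ , o , _) ← reduced-≼ rx x≼z =
        (λ l → <ᵥ-irrefl (pt≼pt l) o) , (λ l → <ᵥ-irrefl (sym (pt≼pt l)) o)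

      below : ∀ b → x ≼ b → b ≼ pt u₁ t → b ≼ pt u₂ t → b ≼ z
      below b l l₁ l₂ with ≼-linear l x≼z
      ... | inj₁ k = k
      ... | inj₂ (inj₁ here) = here
      ... | inj₂ (inj₁ (left k)) = ⊥-elim (proj₁ incomparable (≼-trans k l₂))
      ... | inj₂ (inj₁ (right k)) = ⊥-elim (proj₂ incomparable (≼-trans k l₁))
      ... | inj₂ (inj₂ (_ , _ , _ , _ , _ , inj₁ (_ , ())))
      ... | inj₂ (inj₂ (_ , _ , _ , _ , _ , inj₂ (_ , ())))

      cover : ∀ e → z ≼ e → e ≡ z ⊎ pt u₁ t ≼ e ⊎ pt u₂ t ≼ e
      cover _ here = inj₁ refl
      cover _ (left l) = inj₂ (inj₁ l)
      cover _ (right l) = inj₂ (inj₂ l)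

      cover′ : ∀ e → z ≼ e → e ≡ z ⊎ pt u₂ t ≼ e ⊎ pt u₁ t ≼ e
      cover′ _ here = inj₁ refl
      cover′ _ (left l) = inj₂ (inj₂ l)
      cover′ _ (right l) = inj₂ (inj₁ l)

      go : ∀ {d₁ d₂} → (d₁ ≡ pt u₁ t × d₂ ≡ pt u₂ t) ⊎ (d₁ ≡ pt u₂ t × d₂ ≡ pt u₁ t) →
        ImageOf (pt _ _) d₁ → ImageOf (pt _ _) d₂ → ImageOf (dia _ _ _ _) z
      go (inj₁ (refl , refl)) q₁ q₂ = merge nl q₁ q₂ x≼z (left here) (right here) cover below
      go (inj₂ (refl , refl)) q₁ q₂ = merge nl q₁ q₂ x≼z (right here) (left here) cover′
        (λ b l l₁ l₂ → below b l l₂ l₁)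

    image-pt : last (pt v c) ≡ last x → ∃ (ImageOf c) → ∃ (ImageOf (pt v c))
    image-pt {v = v} {c} e (d , p) with x ≼? pt v c
    ... | yes l = _ , inside l
    ... | no nl = d , above nl p

    image : ∀ c → last c ≡ last x → ∃ (ImageOf c)
    image (top _) refl = _ , inside (≼-last x)
    image (pt v c) e = image-pt {v = v} e (image c e)
    image (dia v w₁ w₂ c) e with x ≼? dia v w₁ w₂ c
    ... | yes l = _ , inside l
    ... | no nl = image-join nl (proj₂ (image-pt {v = w₁} e (image c e))) (proj₂ (image-pt {v = w₂} e (image c e)))

    retract-valid : ∀ ψ → x ⊩ ψ → ∀ c → Reduced (full n) c → c ⊩ sub (retract x) ψ
    retract-valid ψ p c r with last c ≟ᵥ last x
    ... | yes e =
      let (d , q) = image c e in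
      proj₁ (forces-sub _≼_ atom (retract x) ψ)
        (proj₂ (bisimulation _≼_ _ _≼_ atom (λ _ → ⊤) (λ e d → Reduced (full n) e × ImageOf e d)
          (λ i _ (s , q) →
            (λ a → let (b , l , t , k) = proj₁ (retract-forces s i) a in
              ⊑-at (root-mono (persistent-≼ (reduced⇒persistent x rx) l) (proj₁ (image-sees q l) k)) i t) ,
            (λ a → let l = image-inside q in
              proj₂ (retract-forces s i) (_ , l , a , proj₂ (image-sees q l) here)))
          (λ (s , q) k → let (d′ , l , q′) = image-forth q k in d′ , l , reduced-≼ s k , q′)
          (λ (s , q) k → let (c′ , l , q′) = image-back q k in c′ , l , reduced-≼ s l , q′)
          ψ (allVars-⊤ ψ) (r , q))
        (persistence (reduced⇒persistent x rx) ψ (image-inside q) p))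
    -- Models whose greatest point differs from that of x see nothing of x; they are mapped to the
    -- greatest point of x.
    ... | no ne =
      proj₁ (forces-sub _≼_ atom (retract x) ψ)
        (proj₂ (bisimulation _≼_ _ _≼_ atom (λ _ → ⊤)
          (λ e d → Reduced (full n) e × last e ≢ last x × d ≡ top (last x))
          (λ { i _ (s , ne′ , refl) →
            (λ a → let (b , l , t , _) = proj₁ (retract-forces s i) a in
              ⊑-at (root-mono (persistent-≼ (reduced⇒persistent x rx) l)
                (subst (λ v → b ≼ top v) (sym (last-≼ l)) (≼-last b))) i t) ,
            (λ a → proj₂ (retract-forces s i) (top (last x) , ≼-last x , a ,
              λ e k l → ⊥-elim (ne′ (trans (last-≼ k) (sym (last-≼ l)))))) })
          (λ { (s , ne′ , refl) k → _ , here , reduced-≼ s k , (λ q → ne′ (trans (last-≼ k) q)) , refl })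
          (λ { (s , ne′ , refl) here → _ , here , s , ne′ , refl })
          ψ (allVars-⊤ ψ) (r , ne , refl))
        (persistence (reduced⇒persistent x rx) ψ (≼-last x) p))

    retract-fixes : ∀ ψ {c} → x ≼ c → c ⊩ sub (retract x) ψ ⟷ c ⊩ ψ
    retract-fixes ψ {c} l =
      let eqv = bisimulation _≼_ (λ c i → c ⊩ retract x i) _≼_ atom (λ _ → ⊤) (λ e d → e ≡ d × x ≼ e)
            (λ { i _ (refl , l) →
              (λ a → let (b , l′ , t , s) = proj₁ (retract-forces (reduced-≼ rx l) i) a in
                ⊑-at (root-mono (persistent-≼ (reduced⇒persistent x rx) l′) (s _ here l)) i t) ,
              (λ a → proj₂ (retract-forces (reduced-≼ rx l) i) (_ , l , a , λ e k _ → k)) })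
            (λ { (refl , l) k → _ , k , refl , ≼-trans l k })
            (λ { (refl , l) k → _ , k , refl , ≼-trans l k })
            ψ (allVars-⊤ ψ) (refl , l)
      in proj₁ eqv ∘ proj₂ (forces-sub _≼_ atom (retract x) ψ) ,
         proj₁ (forces-sub _≼_ atom (retract x) ψ) ∘ proj₂ eqv

⊢-⋀ : ∀ {L} {Δ : Formula → Set} → ∀ Γ → (∀ {φ} → φ ∈ Γ → Δ ⊢[ L ] φ) → Δ ⊢[ L ] ⋀ Γ
⊢-⋀ {L} [] h =
  theorem (mp-cl L (mp-cl L (ipc-cl L (ax-S ⊥' (⊥' ⇒ ⊥') ⊥')) (ipc-cl L (ax-K ⊥' (⊥' ⇒ ⊥')))) (ipc-cl L (ax-K ⊥' ⊥')))
⊢-⋀ {L} (φ ∷ Γ) h = mp (mp (theorem (ipc-cl L (ax-∧I φ (⋀ Γ)))) (h (here refl))) (⊢-⋀ Γ (h ∘ there))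

module _ (L : IntermediateLogic) (within : VarietyWithinDHA L) where

  valid⇒Thm : ∀ φ → AllVars (_< n) φ → (∀ (c : Code n) → Reduced (full n) c → c ⊩ φ) → Thm L φ
  valid⇒Thm φ p h = within φ (validDHA φ p h)

  -- Nothing is assumed of the rules of `R`: it receives the unified premises as theorems of `L`,
  -- admissibility returns the instances of `φ`, and the way back from these to `φ` is a derivation
  -- in `L`.
  hereditarilyStructurallyComplete : HereditarilyStructurallyComplete L
  hereditarilyStructurallyComplete R ext Γ φ adm =
    cut R from-Γ (ext Δ φ (mp (mp (theorem cover) (⊢-⋀ Γ (hyp ∘ ∈-++⁺ˡ))) (⊢-⋀ instances (hyp ∘ ∈-++⁺ʳ Γ))))
    where
    n₀ = bound (⋀ Γ ⇒ φ)

    open Retraction {n₀}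

    Γ-bounded : ∀ {ψ} → ψ ∈ Γ → AllVars (_< n₀) ψ
    Γ-bounded {ψ} l = allVars-bound ψ (≤-trans (bound-⋀ Γ l) (m≤m⊔n _ _))

    φ-bounded : AllVars (_< n₀) φ
    φ-bounded = allVars-bound φ (m≤n⊔m (bound (⋀ Γ)) _)

    Model? = λ (c : Code n₀) → reduced? (full n₀) c ×-dec (c ⊩? ⋀ Γ)
    models = filter Model? (reducedCodes n₀)
    instances = map (λ x → sub (retract x) φ) models
    Δ = Γ ++ instances

    sub-bounded : ∀ x ψ → AllVars (_< n₀) ψ → AllVars (_< n₀) (sub (retract x) ψ)
    sub-bounded x = allVars-sub (λ i _ → retract-bounded x i)

    unifies : ∀ {x} → x ∈ models → ∀ {ψ} → ψ ∈ Γ → _⊢_ R [] (sub (retract x) ψ)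
    unifies {x} l {ψ} k = let (rx , p) = proj₂ (∈-filter⁻ Model? {xs = reducedCodes n₀} l) in
      ext [] _ (theorem (valid⇒Thm _ (sub-bounded x ψ (Γ-bounded k))
        (retract-valid x rx ψ (proj₁ (⊩-⋀ Γ) p k))))

    from-Γ : ∀ {ψ} → ψ ∈ Δ → _⊢_ R Γ ψ
    from-Γ l with ∈-++⁻ Γ l
    ... | inj₁ k = reflex R k
    ... | inj₂ k with ∈-map⁻ _ k
    ...   | x , k′ , refl = mono R (λ ()) (adm (retract x) (unifies k′))

    cover : Thm L (⋀ Γ ⇒ ⋀ instances ⇒ φ)
    cover = valid⇒Thm _
      (allVars-⋀ Γ Γ-bounded , allVars-⋀ instances instances-bounded , φ-bounded)
      λ c r e l p d k q →
        let re = reduced-≼ r l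
            e∈ = ∈-filter⁺ Model? (∈-reducedCodes e re) (re , p) in
        -- The retraction is that of the point where `⋀ Γ` holds. It fixes the whole upset, hence
        -- also the later point where the instances hold.
        proj₁ (retract-fixes e re φ k) (proj₁ (⊩-⋀ instances) q (∈-map⁺ _ e∈))
      where
      instances-bounded : ∀ {ψ} → ψ ∈ instances → AllVars (_< n₀) ψ
      instances-bounded k with ∈-map⁻ _ k
      ... | x , _ , refl = sub-bounded x φ φ-bounded

private variable
  t k k₁ k₂ : Code n

-- Beth definability

does-true : {A : Set} (a? : Dec A) → does a? ≡ true → A
does-true (yes a) _ = a

-- A candidate deformation of the upset of u: it moves only u and, if u is the root of a diamond, the two
-- middle points of that diamond.
shift : Code n → Code n → Code n → Code n → Code n → Code n
shift u@(dia v w₁ w₂ t) k k₁ k₂ b with b ≟ᶜ u | b ≟ᶜ pt w₁ t | b ≟ᶜ pt w₂ t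
... | yes _ | _ | _ = k
... | no _ | yes _ | _ = k₁
... | no _ | no _ | yes _ = k₂
... | no _ | no _ | no _ = b
shift u k _ _ b with b ≟ᶜ u
... | yes _ = k
... | no _ = b

module Epic {n : ℕ} (m : Vec Bool n) where

  -- The restriction of h to the upset of u is a p-morphism that cannot be noticed by the variables in m.
  record Deformation (u : Code n) (h : Code n → Code n) : Set where
    field
      monotone  : ∀ {b d} → u ≼ b → b ≼ d → h b ≼ h d
      back  : ∀ {b d} → u ≼ b → h b ≼ d → ∃ λ b′ → b ≼ b′ × h b′ ≡ d
      agree : ∀ {b} → u ≼ b → reduce m (h b) ≡ reduce m b

  -- Such a `k` can replace a point immediately below `t`: its strict successors all lie above `t`,
  -- where the deformation is the identity.
  Over : Code n → Code n → Set
  Over t k = k ≼ t × (∀ d → k ≼ d → d ≡ k ⊎ t ≼ d)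

  over-refl : Over t t
  over-refl = here , λ _ l → inj₂ l

  over-pt : Over t (pt v t)
  over-pt = up here , λ { _ here → inj₁ refl ; _ (up l) → inj₂ l }

  deform-pt : (h : Code n → Code n) → h (pt v t) ≡ k → (∀ b → t ≼ b → h b ≡ b) → Over t k →
    reduce m k ≡ reduce m (pt v t) → Deformation (pt v t) h
  deform-pt {v = v} {t} {k} h hu ht (k≼t , cov) r = record { monotone = monotone ; back = back ; agree = agree }
    where
    monotone : ∀ {b d} → pt v t ≼ b → b ≼ d → h b ≼ h d
    monotone here here = here
    monotone here (up l) rewrite hu | ht _ l = ≼-trans k≼t l
    monotone (up l) l′ rewrite ht _ l | ht _ (≼-trans l l′) = l′

    back : ∀ {b d} → pt v t ≼ b → h b ≼ d → ∃ λ b′ → b ≼ b′ × h b′ ≡ d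
    back {d = d} here l rewrite hu with cov d l
    ... | inj₁ refl = _ , here , hu
    ... | inj₂ l′ = d , up l′ , ht d l′
    back {d = d} (up l) l′ rewrite ht _ l = d , l′ , ht d (≼-trans l l′)

    agree : ∀ {b} → pt v t ≼ b → reduce m (h b) ≡ reduce m b
    agree here rewrite hu = r
    agree (up l) rewrite ht _ l = refl

  -- Each middle point with its upset is an instance of `deform-pt`; only the root is new. The root
  -- may move to a middle point, which folds the diamond onto a chain.
  deform-dia : (h : Code n → Code n) → h (dia v w₁ w₂ t) ≡ k → h (pt w₁ t) ≡ k₁ → h (pt w₂ t) ≡ k₂ →
    (∀ b → t ≼ b → h b ≡ b) → Over t k → Over t k₁ → Over t k₂ → k ≼ k₁ → k ≼ k₂ →
    reduce m k ≡ reduce m (dia v w₁ w₂ t) → reduce m k₁ ≡ reduce m (pt w₁ t) →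
    reduce m k₂ ≡ reduce m (pt w₂ t) → Deformation (dia v w₁ w₂ t) h
  deform-dia {v = v} {w₁} {w₂} {t} {k} h hu h₁ h₂ ht (k≼t , cov) o₁ o₂ l₁ l₂ r r₁ r₂ =
    record { monotone = monotone ; back = back ; agree = agree }
    where
    open Deformation (deform-pt h h₁ ht o₁ r₁) renaming (monotone to monotone₁; back to back₁; agree to agree₁)
    open Deformation (deform-pt h h₂ ht o₂ r₂) renaming (monotone to monotone₂; back to back₂; agree to agree₂)

    monotone : ∀ {b d} → dia v w₁ w₂ t ≼ b → b ≼ d → h b ≼ h d
    monotone here here = here
    monotone here (left l) = ≼-trans (subst (_≼ h (pt w₁ t)) (sym hu) (subst (k ≼_) (sym h₁) l₁)) (monotone₁ here l)
    monotone here (right l) = ≼-trans (subst (_≼ h (pt w₂ t)) (sym hu) (subst (k ≼_) (sym h₂) l₂)) (monotone₂ here l)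
    monotone (left l) = monotone₁ l
    monotone (right l) = monotone₂ l

    back : ∀ {b d} → dia v w₁ w₂ t ≼ b → h b ≼ d → ∃ λ b′ → b ≼ b′ × h b′ ≡ d
    back {d = d} here l rewrite hu with cov d l
    ... | inj₁ refl = _ , here , hu
    ... | inj₂ l′ = d , left (up l′) , ht d l′
    back (left l) = back₁ l
    back (right l) = back₂ l

    agree : ∀ {b} → dia v w₁ w₂ t ≼ b → reduce m (h b) ≡ reduce m b
    agree here rewrite hu = r
    agree (left l) = agree₁ l
    agree (right l) = agree₂ l

  module _ (v : Vec Bool n) (t k k₁ k₂ : Code n) where

    shift-pt : shift (pt v t) k k₁ k₂ (pt v t) ≡ k
    shift-pt with pt v t ≟ᶜ pt v t
    ... | yes _ = refl
    ... | no ne = ⊥-elim (ne refl)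

    shift-above-pt : ∀ b → t ≼ b → shift (pt v t) k k₁ k₂ b ≡ b
    shift-above-pt b l with b ≟ᶜ pt v t
    ... | yes refl = ⊥-elim (pt-irrefl l)
    ... | no _ = refl

  module _ (v w₁ w₂ : Vec Bool n) (t k k₁ k₂ : Code n) where

    private
      u′ = dia v w₁ w₂ t

    shift-dia : shift u′ k k₁ k₂ u′ ≡ k
    shift-dia with u′ ≟ᶜ u′ | u′ ≟ᶜ pt w₁ t | u′ ≟ᶜ pt w₂ t
    ... | yes _ | _ | _ = refl
    ... | no ne | _ | _ = ⊥-elim (ne refl)

    shift-left : shift u′ k k₁ k₂ (pt w₁ t) ≡ k₁
    shift-left with pt w₁ t ≟ᶜ u′ | pt w₁ t ≟ᶜ pt w₁ t | pt w₁ t ≟ᶜ pt w₂ t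
    ... | no _ | yes _ | _ = refl
    ... | no _ | no ne | _ = ⊥-elim (ne refl)

    shift-right : w₁ ≢ w₂ → shift u′ k k₁ k₂ (pt w₂ t) ≡ k₂
    shift-right ne with pt w₂ t ≟ᶜ u′ | pt w₂ t ≟ᶜ pt w₁ t | pt w₂ t ≟ᶜ pt w₂ t
    ... | no _ | yes refl | _ = ⊥-elim (ne refl)
    ... | no _ | no _ | yes _ = refl
    ... | no _ | no _ | no ne′ = ⊥-elim (ne′ refl)

    shift-above-dia : ∀ b → t ≼ b → shift u′ k k₁ k₂ b ≡ b
    shift-above-dia b l with b ≟ᶜ u′ | b ≟ᶜ pt w₁ t | b ≟ᶜ pt w₂ t
    ... | no _ | no _ | no _ = refl
    ... | yes refl | _ | _ with () ← ≼-antisym l (left (up here))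
    shift-above-dia b l | no _ | yes refl | _ = ⊥-elim (pt-irrefl l)
    shift-above-dia b l | no _ | no _ | yes refl = ⊥-elim (pt-irrefl l)

  -- A deformation that carries a point where `y` fails to one where it holds. The targets are
  -- stored, and lie above `c`, so that the deformation is one of a finite list.
  record Clash (c : Code n) (y : ℕ) : Set where
    field
      source target target₁ target₂ : Code n
      source-above  : c ≼ source
      target-above  : c ≼ target
      target₁-above : c ≼ target₁
      target₂-above : c ≼ target₂
      shift-source  : shift source target target₁ target₂ source ≡ target
      deformation   : Deformation source (shift source target target₁ target₂)
      target-atom   : atom target y
      source-clear  : ¬ atom source y

  clash-pt : ∀ {y} → c ≼ pt v t → c ≼ k → Over t k → reduce m k ≡ reduce m (pt v t) →
    atom k y → ¬ atom (pt v t) y → Clash c y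
  clash-pt {v = v} {t} {k} l l′ o r a na = record
    { target₁ = t ; target₂ = t ; source-above = l ; target-above = l′
    ; target₁-above = ≼-trans l (up here) ; target₂-above = ≼-trans l (up here)
    ; shift-source = shift-pt v t k t t
    ; deformation = deform-pt _ (shift-pt v t k t t) (shift-above-pt v t k t t) o r
    ; target-atom = a ; source-clear = na }

  clash-dia : ∀ {y} → w₁ ≢ w₂ → c ≼ dia v w₁ w₂ t → c ≼ k → Over t k → Over t k₁ → Over t k₂ → k ≼ k₁ → k ≼ k₂ →
    reduce m k ≡ reduce m (dia v w₁ w₂ t) → reduce m k₁ ≡ reduce m (pt w₁ t) →
    reduce m k₂ ≡ reduce m (pt w₂ t) → atom k y → ¬ atom (dia v w₁ w₂ t) y → Clash c y
  clash-dia {w₁ = w₁} {w₂} {v = v} {t} {k} {k₁} {k₂} ne l l′ o o₁ o₂ l₁ l₂ r r₁ r₂ a na = record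
    { source-above = l ; target-above = l′
    ; target₁-above = ≼-trans l′ l₁ ; target₂-above = ≼-trans l′ l₂
    ; shift-source = shift-dia v w₁ w₂ t k k₁ k₂
    ; deformation = deform-dia _ (shift-dia v w₁ w₂ t k k₁ k₂) (shift-left v w₁ w₂ t k k₁ k₂)
        (shift-right v w₁ w₂ t k k₁ k₂ ne) (shift-above-dia v w₁ w₂ t k k₁ k₂) o o₁ o₂ l₁ l₂ r r₁ r₂
    ; target-atom = a ; source-clear = na }

  reduce-squeeze : c ≼ d → d ≼ e → reduce m c ≡ reduce m e → reduce m c ≡ reduce m d
  reduce-squeeze l l′ r =
    ≼-antisym (reduce-mono m l) (subst (_ ≼_) (sym r) (reduce-mono m l′))

  -- By the back condition of reduce, a middle point of a diamond is identified with its sibling or with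
  -- the point above it as soon as its sibling is identified with the root.
  sibling-image : reduce m (pt v t) ≼ reduce m (pt w t) →
    ∃ λ k → Over t k × pt v t ≼ k × reduce m k ≡ reduce m (pt w t)
  sibling-image {v = v} {t} {w} l with reduce-back m (pt v t) l
  ... | _ , here , r = pt v t , over-pt , here , r
  ... | d , up l′ , r = t , over-refl , up here ,
        ≼-antisym (subst (reduce m t ≼_) r (reduce-mono m l′)) (reduce-mono {c = pt w t} m (up here))

  clash-comparable : ∀ {y} → Reduced (full n) d → c ≼ d → d ≼ e → reduce m d ≡ reduce m e →
    atom e y → ¬ atom d y → Clash c y
  clash-comparable rd l here r a na = ⊥-elim (na a)
  clash-comparable {d = pt v t} {y = y} rd l (up l′) r a na with at (root t) y ≟ᵇ true
  ... | yes a′ = clash-pt l (≼-trans l (up here)) over-refl (sym (reduce-squeeze {c = pt v t} (up here) l′ r)) a′ na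
  ... | no na′ = clash-comparable (reduced-≼ rd (up here)) (≼-trans l (up here)) l′
          (trans (sym (reduce-squeeze {c = pt v t} (up here) l′ r)) r) a na′
  clash-comparable {d = dia v w₁ w₂ t} {y = y} rd l (left l′) r a na with at w₁ y ≟ᵇ true
  ... | no na′ = clash-comparable (reduced-≼ rd (left here)) (≼-trans l (left here)) l′
          (trans (sym (reduce-squeeze {c = dia v w₁ w₂ t} (left here) l′ r)) r) a na′
  ... | yes a′ =
    let r₁ = reduce-squeeze {c = dia v w₁ w₂ t} (left here) l′ r
        -- When the root moves to `pt w₁ t`, monotonicity requires the image of the sibling to lie
        -- above `pt w₁ t` as well.
        (k , o , l″ , r₂) = sibling-image {w = w₂} (subst (_≼ reduce m (pt w₂ t)) r₁
          (reduce-mono {c = dia v w₁ w₂ t} m (right here)))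
        ne = λ e → <ᵥ-irrefl e (proj₁ (proj₂ (proj₂ rd))) in
    clash-dia ne l (≼-trans l (left here)) over-pt over-pt o here l″ (sym r₁) refl r₂ a′ na
  clash-comparable {d = dia v w₁ w₂ t} {y = y} rd l (right l′) r a na with at w₂ y ≟ᵇ true
  ... | no na′ = clash-comparable (reduced-≼ rd (right here)) (≼-trans l (right here)) l′
          (trans (sym (reduce-squeeze {c = dia v w₁ w₂ t} (right here) l′ r)) r) a na′
  ... | yes a′ =
    let r₂ = reduce-squeeze {c = dia v w₁ w₂ t} (right here) l′ r
        (k , o , l″ , r₁) = sibling-image {w = w₁} (subst (_≼ reduce m (pt w₁ t)) r₂
          (reduce-mono {c = dia v w₁ w₂ t} m (left here)))
        ne = λ e → <ᵥ-irrefl e (proj₁ (proj₂ (proj₂ rd))) in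
    clash-dia ne l (≼-trans l (right here)) over-pt o over-pt l″ here (sym r₂) r₁ refl a′ na

  -- Incomparable points are siblings below the same point, and one can be moved onto the other
  -- directly.
  clash : ∀ {y} → Reduced (full n) c → c ≼ d → c ≼ e → reduce m d ≡ reduce m e →
    atom e y → ¬ atom d y → Clash c y
  clash {e = e} {y} rc l l′ r a na with ≼-linear l l′
  ... | inj₁ k = clash-comparable (reduced-≼ rc l) l k r a na
  ... | inj₂ (inj₁ k) =
    ⊥-elim (na (⊑-at (root-mono (reduced⇒persistent e (reduced-≼ rc l′)) k) y a))
  ... | inj₂ (inj₂ (_ , _ , _ , _ , _ , inj₁ (refl , refl))) = clash-pt l l′ over-pt (sym r) a na
  ... | inj₂ (inj₂ (_ , _ , _ , _ , _ , inj₂ (refl , refl))) = clash-pt l l′ over-pt (sym r) a na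

-- Substitutions and finite lists of variables

sub-id : ∀ {σ} φ → AllVars (λ i → σ i ≡ var i) φ → sub σ φ ≡ φ
sub-id (var i) p = p
sub-id ⊥' _ = refl
sub-id (φ ∧ ψ) (p , q) = cong₂ _∧_ (sub-id φ p) (sub-id ψ q)
sub-id (φ ∨ ψ) (p , q) = cong₂ _∨_ (sub-id φ p) (sub-id ψ q)
sub-id (φ ⇒ ψ) (p , q) = cong₂ _⇒_ (sub-id φ p) (sub-id ψ q)

sub-ren : ∀ {σ τ} c φ → AllVars (λ i → σ (c i) ≡ τ i) φ → sub σ (ren c φ) ≡ sub τ φ
sub-ren c (var i) p = p
sub-ren c ⊥' _ = refl
sub-ren c (φ ∧ ψ) (p , q) = cong₂ _∧_ (sub-ren c φ p) (sub-ren c ψ q)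
sub-ren c (φ ∨ ψ) (p , q) = cong₂ _∨_ (sub-ren c φ p) (sub-ren c ψ q)
sub-ren c (φ ⇒ ψ) (p , q) = cong₂ _⇒_ (sub-ren c φ p) (sub-ren c ψ q)

-- AllVars is informative: it records for each occurrence of a variable to which side it belongs.
record Sorted (X Y : ℕ → Set) (φ : Formula) : Set where
  field
    xs ys : List ℕ
    xs⊆X : ∀ {i} → i ∈ xs → X i
    ys⊆Y : ∀ {i} → i ∈ ys → Y i
    sorted : AllVars (λ i → i ∈ xs ⊎ i ∈ ys) φ

module _ {X Y : ℕ → Set} where
  open Sorted

  private
    both : (_∙_ : Formula → Formula → Formula) →
      (∀ {P} φ ψ → AllVars P φ → AllVars P ψ → AllVars P (φ ∙ ψ)) →
      ∀ φ ψ → Sorted X Y φ → Sorted X Y ψ → Sorted X Y (φ ∙ ψ)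
    both _∙_ pair φ ψ s t = record
      { xs = xs s ++ xs t ; ys = ys s ++ ys t
      ; xs⊆X = λ l → case-++ (xs s) (xs⊆X s) (xs⊆X t) l
      ; ys⊆Y = λ l → case-++ (ys s) (ys⊆Y s) (ys⊆Y t) l
      ; sorted = pair φ ψ
          (allVars-map (λ _ → λ { (inj₁ l) → inj₁ (∈-++⁺ˡ l) ; (inj₂ l) → inj₂ (∈-++⁺ˡ l) }) φ (sorted s))
          (allVars-map (λ _ → λ { (inj₁ l) → inj₁ (∈-++⁺ʳ (xs s) l) ; (inj₂ l) → inj₂ (∈-++⁺ʳ (ys s) l) }) ψ (sorted t)) }
      where
      case-++ : {P : ℕ → Set} {i : ℕ} (as : List ℕ) {bs : List ℕ} →
        (∀ {i} → i ∈ as → P i) → (∀ {i} → i ∈ bs → P i) → i ∈ as ++ bs → P i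
      case-++ as f g l with ∈-++⁻ as l
      ... | inj₁ k = f k
      ... | inj₂ k = g k

  sort : ∀ φ → AllVars (λ i → X i ⊎ Y i) φ → Sorted X Y φ
  sort (var i) (inj₁ p) = record
    { xs = i ∷ [] ; ys = [] ; xs⊆X = λ { (here refl) → p } ; ys⊆Y = λ () ; sorted = inj₁ (here refl) }
  sort (var i) (inj₂ p) = record
    { xs = [] ; ys = i ∷ [] ; xs⊆X = λ () ; ys⊆Y = λ { (here refl) → p } ; sorted = inj₂ (here refl) }
  sort ⊥' _ = record { xs = [] ; ys = [] ; xs⊆X = λ () ; ys⊆Y = λ () ; sorted = tt }
  sort (φ ∧ ψ) (p , q) = both _∧_ (λ _ _ → _,_) φ ψ (sort φ p) (sort ψ q)
  sort (φ ∨ ψ) (p , q) = both _∨_ (λ _ _ → _,_) φ ψ (sort φ p) (sort ψ q)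
  sort (φ ⇒ ψ) (p , q) = both _⇒_ (λ _ _ → _,_) φ ψ (sort φ p) (sort ψ q)

joins : {A : Set} → (A → Formula) → List A → List Formula
joins f [] = ⊥' ∷ []
joins f (x ∷ xs) = cartesianProductWith _∨_ (f x ∷ ⊥' ∷ []) (joins f xs)

join∈joins : {A : Set} (t : A → Bool) (f : A → Formula) (xs : List A) → join t f xs ∈ joins f xs
join∈joins t f [] = here refl
join∈joins t f (x ∷ xs) with t x
... | true = ∈-cartesianProductWith⁺ _∨_ {xs = f x ∷ ⊥' ∷ []} (here refl) (join∈joins t f xs)
... | false = ∈-cartesianProductWith⁺ _∨_ {xs = f x ∷ ⊥' ∷ []} (there (here refl)) (join∈joins t f xs)

allVars-joins : {A : Set} {P : ℕ → Set} {f : A → Formula} → (∀ x → AllVars P (f x)) → ∀ xs →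
  ∀ {φ} → φ ∈ joins f xs → AllVars P φ
allVars-joins h [] (here refl) = tt
allVars-joins {f = f} h (x ∷ xs) l with ∈-cartesianProductWith⁻ _∨_ (f x ∷ ⊥' ∷ []) (joins f xs) l
... | _ , _ , here refl , k , refl = h x , allVars-joins h xs k
... | _ , _ , there (here refl) , k , refl = tt , allVars-joins h xs k

-- Candidate definitions and the explicit definition by cases

module _ (L : IntermediateLogic) (within : VarietyWithinDHA L) where

  -- Spares derivations from the axioms: intuitionistic laws are checked in reduced codes.
  tautology : ∀ φ → (∀ {n} (c : Code n) → Reduced (full n) c → c ⊩ φ) → Thm L φ
  tautology φ h = valid⇒Thm L within φ (allVars-bound φ ≤-refl) h

  -- γ is the conjunction of the premises from Γ that occur in the derivation, as originals or as copies.
  premise : {Γ : Formula → Set} (c : ℕ → ℕ) →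
    (λ φ → Γ φ ⊎ Σ Formula (λ ψ → Γ ψ × φ ≡ ren c ψ)) ⊢[ L ] φ →
    {P : ℕ → Set} → (∀ ψ → Γ ψ → AllVars P ψ) →
    Σ Formula λ γ → AllVars P γ × Γ ⊢[ L ] γ × Thm L (γ ⇒ ren c γ ⇒ φ)
  premise {φ} c (hyp (inj₁ p)) hΓ = φ , hΓ φ p , hyp p ,
    tautology _ (λ d r _ l p _ l′ _ → persistence (reduced⇒persistent _ (reduced-≼ r l)) φ l′ p)
  premise c (hyp (inj₂ (ψ , p , refl))) hΓ = ψ , hΓ ψ p , hyp p , tautology _ (λ _ _ _ _ _ _ _ q → q)
  premise {φ} c (theorem t) hΓ = ⊤' , (tt , tt) ,
    theorem (tautology ⊤' (λ _ _ _ _ q → q)) ,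
    mp-cl L (tautology (φ ⇒ ⊤' ⇒ ⊤' ⇒ φ) λ _ r _ l p _ l₁ _ _ l₂ _ →
      persistence (reduced⇒persistent _ (reduced-≼ r l)) φ (≼-trans l₁ l₂) p) t
  premise {ψ} {Γ} c (mp {φ = φ} d e) hΓ =
    let (γ₁ , v₁ , p₁ , t₁) = premise c d hΓ
        (γ₂ , v₂ , p₂ , t₂) = premise c e hΓ
    in γ₁ ∧ γ₂ , (v₁ , v₂) , mp (mp (theorem (ipc-cl L (ax-∧I γ₁ γ₂))) p₁) p₂ ,
       mp-cl L (mp-cl L (tautology
         ((γ₁ ⇒ ren c γ₁ ⇒ φ ⇒ ψ) ⇒ (γ₂ ⇒ ren c γ₂ ⇒ φ) ⇒ γ₁ ∧ γ₂ ⇒ ren c γ₁ ∧ ren c γ₂ ⇒ ψ)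
         λ _ _ _ _ f _ l₁ g _ l₂ (a₁ , a₂) z l₃ (b₁ , b₂) →
           f _ (≼-trans l₁ l₂) a₁ z l₃ b₁ z here (g _ l₂ a₂ z l₃ b₂)) t₁) t₂

  module _ (X Y : ℕ → Set) (disjoint : ∀ n → X n → Y n → ⊥)
           (Γ : Formula → Set) (hΓ : ∀ φ → Γ φ → AllVars (λ n → X n ⊎ Y n) φ)
           (c : ℕ → ℕ) (c-X : ∀ x → X x → c x ≡ x)
           (c-inj : ∀ y y′ → Y y → Y y′ → c y ≡ c y′ → y ≡ y′)
           (c-fresh : ∀ y → Y y → ¬ X (c y) × ¬ Y (c y))
           (implicit : ∀ y → Y y →
             (λ φ → Γ φ ⊎ Σ Formula (λ ψ → Γ ψ × φ ≡ ren c ψ)) ⊢[ L ] (var y ⇔ var (c y))) where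

    -- Undoes the copying and applies τ, turning `ren c γ` into `sub τ γ` while keeping γ. A finite
    -- list is searched because membership in `Y` need not be decidable.
    uncopy : Subst → List ℕ → Subst
    uncopy τ [] i = var i
    uncopy τ (z ∷ zs) i with i ≟ c z
    ... | yes _ = τ z
    ... | no _ = uncopy τ zs i

    uncopy-copy : ∀ τ zs → (∀ {z} → z ∈ zs → Y z) → ∀ {y} → Y y → y ∈ zs → uncopy τ zs (c y) ≡ τ y
    uncopy-copy τ (z ∷ zs) h {y} Yy l with c y ≟ c z
    ... | yes e = cong τ (sym (c-inj y z Yy (h (here refl)) e))
    uncopy-copy τ (z ∷ zs) h Yy (here refl) | no ne = ⊥-elim (ne refl)
    uncopy-copy τ (z ∷ zs) h Yy (there l) | no _ = uncopy-copy τ zs (h ∘ there) Yy l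

    uncopy-other : ∀ τ zs → (∀ {z} → z ∈ zs → Y z) → ∀ {i} → X i ⊎ Y i → uncopy τ zs i ≡ var i
    uncopy-other τ [] h p = refl
    uncopy-other τ (z ∷ zs) h {i} p with i ≟ c z
    uncopy-other τ (z ∷ zs) h (inj₁ p) | yes refl = ⊥-elim (proj₁ (c-fresh z (h (here refl))) p)
    uncopy-other τ (z ∷ zs) h (inj₂ p) | yes refl = ⊥-elim (proj₂ (c-fresh z (h (here refl))) p)
    uncopy-other τ (z ∷ zs) h p | no _ = uncopy-other τ zs (h ∘ there) p

    -- Implicit definability with the disjoint copy replaced by an arbitrary instance. Since τ may
    -- use every variable, including those of `Y`, deformations can be plugged in.
    record Determination (y : ℕ) : Set where
      field
        γ : Formula
        derivable : Γ ⊢[ L ] γ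
        sorting : Sorted X Y γ
      open Sorted sorting public
      field
        determines : ∀ τ → (∀ {x} → x ∈ xs → τ x ≡ var x) → Thm L (γ ⇒ sub τ γ ⇒ (var y ⇔ τ y))

    determination : ∀ y → Y y → Determination y
    determination y Yy = record
      { γ = γ ; derivable = Γ⊢γ ; sorting = s
      ; determines = λ τ τ-x →
          let zs = y ∷ ys
              ρ = uncopy τ zs
              zs⊆Y : ∀ {z} → z ∈ zs → Y z
              zs⊆Y = λ { (here refl) → Yy ; (there l) → ys⊆Y l }
              fixed = sub-id {ρ} γ (allVars-map (λ i → λ
                { (inj₁ l) → uncopy-other τ zs zs⊆Y (inj₁ (xs⊆X l))
                ; (inj₂ l) → uncopy-other τ zs zs⊆Y (inj₂ (ys⊆Y l)) }) γ sorted)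
              copied = sub-ren {ρ} {τ} c γ (allVars-map (λ i → λ
                { (inj₁ l) → trans (cong ρ (c-X i (xs⊆X l)))
                    (trans (uncopy-other τ zs zs⊆Y (inj₁ (xs⊆X l))) (sym (τ-x l)))
                ; (inj₂ l) → uncopy-copy τ zs zs⊆Y (ys⊆Y l) (there l) }) γ sorted)
              yy = cong₂ _⇔_ (uncopy-other τ zs zs⊆Y (inj₂ Yy)) (uncopy-copy τ zs zs⊆Y Yy (here refl))
          in subst (Thm L) (cong₂ _⇒_ fixed (cong₂ _⇒_ copied yy)) (subst-cl L ρ thm) }
      where
      pr = premise c (implicit y Yy) hΓ
      γ = proj₁ pr
      Γ⊢γ = proj₁ (proj₂ (proj₂ pr))
      thm = proj₂ (proj₂ (proj₂ pr))
      s = sort γ (proj₁ (proj₂ pr))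
      open Sorted s

    record Candidates (y : ℕ) : Set where
      field
        candidates : List Formula
        over-X : ∀ {s} → s ∈ candidates → AllVars X s
        one-of : Γ ⊢[ L ] join (λ _ → true) (λ s → var y ⇔ s) candidates

    module _ (y : ℕ) (Yy : Y y) where
      open Determination (determination y Yy)

      private
        -- `y` itself need not occur in γ.
        N = suc y ⊔ bound γ

        M : Vec Bool N
        M = tab N (λ i → does (i ∈? xs))

        open Epic M
        module Ch = Characteristic M
        module Cf = Characteristic (full N)

        γ-bounded : AllVars (_< N) γ
        γ-bounded = allVars-bound γ (m≤n⊔m (suc y) _)

        y-bounded : y < N
        y-bounded = m≤m⊔n (suc y) (bound γ)

        M⇒xs : ∀ {i} → at M i ≡ true → i ∈ xs
        M⇒xs {i} p = does-true (i ∈? xs) (trans (sym (at-tab _ (at-bound M i p))) p)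

        xs⇒M : ∀ {i} → i < N → i ∈ xs → at M i ≡ true
        xs⇒M {i} i<N l = trans (at-tab _ i<N) (dec-true (i ∈? xs) l)

      -- Realises `h` as a substitution: above `u`, the new formula for `i` defines the points whose
      -- image satisfies `i`. Variables in `xs` can stay, since a deformation preserves them.
      pull : Code N → (Code N → Code N) → Subst
      pull u h i with i ∈? xs
      ... | yes _ = var i
      ... | no _ = join (λ b → at (root (h b)) i) Cf.characteristic (ups u)

      pull-xs : ∀ u h {i} → i ∈ xs → pull u h i ≡ var i
      pull-xs u h {i} l with i ∈? xs
      ... | yes _ = refl
      ... | no nl = ⊥-elim (nl l)

      pull-bounded : ∀ u h i → i < N → AllVars (_< N) (pull u h i)
      pull-bounded u h i p with i ∈? xs
      ... | yes _ = p
      ... | no _ = allVars-join _ _ (λ b → Retraction.masked⇒bounded (Cf.characteristic b) (Cf.masked b)) (ups u)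

      module _ {u : Code N} {h : Code N → Code N} (ru : Reduced (full N) u)
               (pu : Persistent (h u)) (D : Deformation u h) where
        open Deformation D

        pull-atom : ∀ i → i < N → ∀ {b} → u ≼ b → b ⊩ pull u h i ⟷ atom (h b) i
        pull-atom i i<N {b} l with i ∈? xs
        ... | yes k = ≡⇒⟷ (cong (_≡ true) (trans (sym (at-reduce M b i∈M))
                (trans (cong (λ d → at (root d) i) (sym (agree l))) (at-reduce M (h b) i∈M))))
          where i∈M = xs⇒M i<N k
        ... | no _ =
          (λ p → let (d , k , a , q) = proj₁ (⊩-join _ _ (ups u)) p
                     u≼d = ∈ups⇒≼ k
                     d≼b = proj₁ (Cf.correct d (reduced-≼ ru u≼d) b (reduced-≼ ru l)) q in
            ⊑-at (root-mono (persistent-≼ pu (monotone here u≼d)) (monotone u≼d d≼b)) i a) ,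
          (λ a → proj₂ (⊩-join _ _ (ups u)) (b , ≼⇒∈ups l , a ,
            proj₂ (Cf.correct b (reduced-≼ ru l) b (reduced-≼ ru l)) here))

        pull-forces : ∀ φ → AllVars (_< N) φ → u ⊩ sub (pull u h) φ ⟷ h u ⊩ φ
        pull-forces φ p =
          let eqv = bisimulation _≼_ (λ b i → b ⊩ pull u h i) _≼_ atom (_< N) (λ b d → u ≼ b × d ≡ h b)
                (λ { i i<N (l , refl) → pull-atom i i<N l })
                (λ { (l , refl) k → _ , monotone l k , ≼-trans l k , refl })
                (λ { (l , refl) k → let (b , k′ , e) = back l k in b , k′ , ≼-trans l k′ , sym e })
                φ p (here , refl)
          in proj₁ eqv ∘ proj₂ (forces-sub _≼_ atom (pull u h) φ) ,
             proj₁ (forces-sub _≼_ atom (pull u h) φ) ∘ proj₂ eqv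

      private
        -- A shift is determined by its source and three targets, so these finitely many
        -- substitutions cover every clash.
        quads = cartesianProduct R (cartesianProduct R (cartesianProduct R R))
          where R = reducedCodes N

        τ : Code N × Code N × Code N × Code N → Subst
        τ (u , k , k₁ , k₂) = pull u (shift u k k₁ k₂)

        θ = λ q → γ ⇒ sub (τ q) γ ⇒ (var y ⇔ τ q y)

        defs = joins Ch.characteristic (reducedCodes N)

        defs-masked : ∀ {s} → s ∈ defs → Ch.Masked s
        defs-masked = allVars-joins Ch.masked (reducedCodes N)

        one-of-defs : Formula
        one-of-defs = join (λ _ → true) (λ s → var y ⇔ s) defs

      module _ (e : Code N) (re : Reduced (full N) e)
               (θs : ∀ {φ} → φ ∈ map θ quads → e ⊩ φ) (e⊩γ : e ⊩ γ) where

        -- As γ holds at the target, its pulled-back instance holds at the source. The premise θ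
        -- then equates `y` with its pulled-back value there, which is true, whereas `y` is false.
        no-clash : ¬ Clash e y
        no-clash C = source-clear (proj₂ (θs (∈-map⁺ θ q∈) source source-above (holds source-above)
            source here (proj₂ pulled (subst (_⊩ γ) (sym shift-source) (holds target-above)))) source here
            (proj₂ (pull-atom ru pk deformation y y-bounded here)
              (subst (λ d → atom d y) (sym shift-source) target-atom)))
          where
          open Clash C
          ru = reduced-≼ re source-above
          holds : ∀ {d} → e ≼ d → d ⊩ γ
          holds l = persistence (reduced⇒persistent e re) γ l e⊩γ
          pk = subst Persistent (sym shift-source)
                 (reduced⇒persistent target (reduced-≼ re target-above))
          pulled = pull-forces ru pk deformation γ γ-bounded
          R∋ : ∀ {d} → e ≼ d → d ∈ reducedCodes N
          R∋ l = ∈-reducedCodes _ (reduced-≼ re l)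
          q∈ : (source , target , target₁ , target₂) ∈ quads
          q∈ = ∈-cartesianProduct⁺ (R∋ source-above)
                 (∈-cartesianProduct⁺ (R∋ target-above) (∈-cartesianProduct⁺ (R∋ target₁-above) (R∋ target₂-above)))

        Image? = λ b → any? (λ d → (at (root d) y ≟ᵇ true) ×-dec (reduce M d ≟ᶜ b)) (ups e)

        -- The upset generated by the reducts of the points where `y` holds.
        definition : Formula
        definition = join (does ∘ Image?) Ch.characteristic (reducedCodes N)

        definition-correct : e ⊩ var y ⇔ definition
        definition-correct = to , from
          where
          red : ∀ {d} → e ≼ d → Reduced M (reduce M d)
          red {d} l = reduce-reduced M d (persistent-≼ (reduced⇒persistent e re) l)

          to : e ⊩ var y ⇒ definition
          to d l a = proj₂ (⊩-join _ _ (reducedCodes N)) (reduce M d , ∈-reducedCodes _ (red l) ,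
            dec-true (Image? (reduce M d)) (lose (≼⇒∈ups l) (a , refl)) ,
            proj₂ (reduce-forces M (Ch.characteristic (reduce M d)) (Ch.masked (reduce M d)))
              (proj₂ (Ch.correct (reduce M d) (red l) (reduce M d) (red l)) here))

          from : e ⊩ definition ⇒ var y
          from d l p with proj₁ (⊩-join (does ∘ Image?) Ch.characteristic (reducedCodes N)) p
          ... | b , _ , t , q with find (does-true (Image? b) t)
          ...   | d₀ , k , a , refl with at (root d) y ≟ᵇ true
          ...     | yes a′ = a′
          ...     | no na =
            let l₀ = ∈ups⇒≼ k
                b≼ = proj₁ (Ch.correct b (red l₀) (reduce M d) (red l))
                       (proj₁ (reduce-forces M (Ch.characteristic b) (Ch.masked b)) q)
                -- Lifting along `reduce` gives a point that satisfies `y` and has the same reduct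
                -- as `d`; if `y` failed at `d`, the two would clash.
                (d₁ , l₁ , r) = reduce-back M d₀ b≼
                a₁ = ⊑-at (root-mono (persistent-≼ (reduced⇒persistent e re) l₀) l₁) y a
            in ⊥-elim (no-clash (clash re l (≼-trans l₀ l₁) (sym r) a₁ na))

      private
        defs-bounded : ∀ {s} → s ∈ defs → AllVars (_< N) s
        defs-bounded {s} l = allVars-map (at-bound M) s (defs-masked l)

        sub-bounded : ∀ q φ → AllVars (_< N) φ → AllVars (_< N) (sub (τ q) φ)
        sub-bounded (u , k , k₁ , k₂) = allVars-sub (pull-bounded u (shift u k k₁ k₂))

        θ-bounded : ∀ {φ} → φ ∈ map θ quads → AllVars (_< N) φ
        θ-bounded l with ∈-map⁻ θ l
        ... | q , _ , refl = γ-bounded , sub-bounded q γ γ-bounded ,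
          ((y-bounded , sub-bounded q (var y) y-bounded) , (sub-bounded q (var y) y-bounded , y-bounded))

        one-of-bounded : ∀ ss → (∀ {s} → s ∈ ss → AllVars (_< N) s) →
          AllVars (_< N) (join (λ _ → true) (λ s → var y ⇔ s) ss)
        one-of-bounded [] h = tt
        one-of-bounded (s ∷ ss) h =
          ((y-bounded , h (here refl)) , (h (here refl) , y-bounded)) , one-of-bounded ss (h ∘ there)

        thm : Thm L (⋀ (map θ quads) ⇒ γ ⇒ one-of-defs)
        thm = valid⇒Thm L within _
          (allVars-⋀ (map θ quads) θ-bounded , γ-bounded , one-of-bounded defs defs-bounded)
          λ c r d l p e l′ q →
            let re = reduced-≼ r (≼-trans l l′)
                ps = persistence (reduced⇒persistent d (reduced-≼ r l)) (⋀ (map θ quads)) l′ p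
                θs : ∀ {φ} → φ ∈ map θ quads → e ⊩ φ
                θs = proj₁ (⊩-⋀ (map θ quads)) ps
            in proj₂ (⊩-join _ _ defs)
              -- The definition varies with the model, but always belongs to the finite list `defs`.
              (definition e re θs q , join∈joins _ _ (reducedCodes N) , refl ,
               definition-correct e re θs q)

        θ-thm : ∀ {φ} → φ ∈ map θ quads → Γ ⊢[ L ] φ
        θ-thm l with ∈-map⁻ θ l
        ... | q@(u , k , k₁ , k₂) , _ , refl = theorem (determines (τ q) (pull-xs u (shift u k k₁ k₂)))

      candidates : Candidates y
      candidates = record
        { candidates = defs
        ; over-X = λ {s} l → allVars-map (λ _ p → xs⊆X (M⇒xs p)) s (defs-masked l)
        ; one-of = mp (mp (theorem thm) (⊢-⋀ (map θ quads) θ-thm)) derivable }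

    agreement : List ℕ → Subst → Formula
    agreement zs σ = ⋀ (map (λ z → var z ⇔ σ z) zs)

    -- Each substitution picks one candidate for every variable of `zs` simultaneously; in each
    -- model at least one such choice is right for all of them.
    record Choices (zs : List ℕ) : Set where
      field
        choices : List Subst
        fixes-X : ∀ {σ} → σ ∈ choices → ∀ x → X x → σ x ≡ var x
        into-X : ∀ {σ} → σ ∈ choices → ∀ {z} → z ∈ zs → AllVars X (σ z)
        some-agrees : Γ ⊢[ L ] join (λ _ → true) (agreement zs) choices

    update : ℕ → Formula → Subst → Subst
    update z s σ i with i ≟ z
    ... | yes _ = s
    ... | no _ = σ i

    update-agreement : ∀ {k} {d : Code k} z s σ zs → d ⊩ var z ⇔ s → d ⊩ agreement zs σ →
      d ⊩ agreement (z ∷ zs) (update z s σ)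
    update-agreement {d = d} z s σ zs p q = proj₂ (⊩-⋀ (map (λ i → var i ⇔ update z s σ i) (z ∷ zs))) all
      where
      all : ∀ {φ} → φ ∈ map (λ i → var i ⇔ update z s σ i) (z ∷ zs) → d ⊩ φ
      all l with ∈-map⁻ (λ i → var i ⇔ update z s σ i) l
      ... | i , l′ , refl with i ≟ z
      ...   | yes refl = p
      all l | i , here e , refl | no ne = ⊥-elim (ne e)
      all l | i , there l′ , refl | no _ = proj₁ (⊩-⋀ (map (λ z → var z ⇔ σ z) zs)) q (∈-map⁺ _ l′)

    choose : ∀ zs → (∀ {z} → z ∈ zs → Y z) → Choices zs
    choose [] _ = record
      { choices = var ∷ [] ; fixes-X = λ { (here refl) _ _ → refl } ; into-X = λ _ ()
      ; some-agrees = theorem (tautology _ λ _ _ → inj₁ λ _ _ ()) }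
    choose (z ∷ zs) h = record
      { choices = σs ; fixes-X = fixes ; into-X = into
      ; some-agrees = mp (mp (theorem (tautology _ both)) one-of) some-agrees }
      where
      open Candidates (candidates z (h (here refl))) renaming (candidates to ss)
      open Choices (choose zs (h ∘ there)) renaming (choices to σs₀)
      σs = cartesianProductWith (update z) ss σs₀

      fixes : ∀ {σ} → σ ∈ σs → ∀ x → X x → σ x ≡ var x
      fixes l x p with ∈-cartesianProductWith⁻ (update z) ss σs₀ l
      ... | s , σ , _ , l₀ , refl with x ≟ z
      ...   | yes refl = ⊥-elim (disjoint x p (h (here refl)))
      ...   | no _ = fixes-X l₀ x p

      into : ∀ {σ} → σ ∈ σs → ∀ {i} → i ∈ z ∷ zs → AllVars X (σ i)
      into l {i} k with ∈-cartesianProductWith⁻ (update z) ss σs₀ l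
      ... | s , σ , l₁ , l₀ , refl with i ≟ z
      ...   | yes _ = over-X l₁
      into l (here e) | s , σ , l₁ , l₀ , refl | no ne = ⊥-elim (ne e)
      into l (there k) | s , σ , l₁ , l₀ , refl | no _ = into-X l₀ k

      both : ∀ {k} (d : Code k) → Reduced (full k) d → d ⊩
        join (λ _ → true) (λ s → var z ⇔ s) ss ⇒ join (λ _ → true) (agreement zs) σs₀ ⇒
        join (λ _ → true) (agreement (z ∷ zs)) σs
      both d r e l p e′ l′ q =
        let (s , s∈ , _ , a) = proj₁ (⊩-join _ _ ss) p
            (σ , σ∈ , _ , b) = proj₁ (⊩-join _ _ σs₀) q
            a′ = persistence (reduced⇒persistent e (reduced-≼ r l)) (var z ⇔ s) l′ a
        in proj₂ (⊩-join _ _ σs) (update z s σ , ∈-cartesianProductWith⁺ (update z) s∈ σ∈ , refl ,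
             update-agreement z s σ zs a′ b)

    explicit : ∀ y → Y y → Σ Formula (λ φ → AllVars X φ × Γ ⊢[ L ] (var y ⇔ φ))
    explicit y Yy = δ , δ-X ,
      mp (mp (mp (theorem (tautology (γ ⇒ ⋀ (map θ choices) ⇒ covered ⇒ (var y ⇔ δ)) correct-δ)) derivable)
        (⊢-⋀ (map θ choices) θ-thm)) some-agrees
      where
      open Determination (determination y Yy)

      zs = y ∷ ys

      zs⊆Y : ∀ {z} → z ∈ zs → Y z
      zs⊆Y (here refl) = Yy
      zs⊆Y (there l) = ys⊆Y l

      open Choices (choose zs zs⊆Y)

      -- `sub σ γ` is a test in the variables of `X`. A right choice passes it because σ agrees with
      -- the model; a wrong choice that passes does no harm, since `θ σ` still equates `y` with
      -- `σ y`.
      branch : Subst → Formula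
      branch σ = sub σ γ ∧ σ y

      δ = join (λ _ → true) branch choices

      θ : Subst → Formula
      θ σ = γ ⇒ sub σ γ ⇒ (var y ⇔ σ y)

      covered = join (λ _ → true) (agreement zs) choices

      δ-X : AllVars X δ
      δ-X = go choices id
        where
        go : ∀ σs → (∀ {σ} → σ ∈ σs → σ ∈ choices) → AllVars X (join (λ _ → true) branch σs)
        go [] _ = tt
        go (σ ∷ σs) h = (allVars-sub σ-X γ sorted , into-X (h (here refl)) (here refl)) , go σs (h ∘ there)
          where
          σ-X : ∀ i → i ∈ xs ⊎ i ∈ ys → AllVars X (σ i)
          σ-X i (inj₁ l) = subst (AllVars X) (sym (fixes-X (h (here refl)) i (xs⊆X l))) (xs⊆X l)
          σ-X i (inj₂ l) = into-X (h (here refl)) (there l)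

      θ-thm : ∀ {ψ} → ψ ∈ map θ choices → Γ ⊢[ L ] ψ
      θ-thm l with ∈-map⁻ θ l
      ... | σ , k , refl = theorem (determines σ λ {x} l → fixes-X k x (xs⊆X l))

      replace : ∀ {k} {d : Code k} σ → σ ∈ choices → d ⊩ agreement zs σ → d ⊩ γ → d ⊩ sub σ γ
      replace {d = d} σ σ∈ a p = proj₁ (forces-sub _≼_ atom σ γ)
        (proj₁ (bisimulation _≼_ atom _≼_ (λ e i → e ⊩ σ i) (λ i → i ∈ xs ⊎ i ∈ ys) (λ e e′ → e ≡ e′ × d ≼ e)
          (λ { i (inj₁ l) (refl , _) → ≡⇒⟷ (cong (_ ⊩_) (sym (fixes-X σ∈ i (xs⊆X l))))
             ; i (inj₂ l) (refl , k) →
                 let (f , g) = proj₁ (⊩-⋀ (map (λ z → var z ⇔ σ z) zs)) a (∈-map⁺ _ (there l)) in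
                 f _ k , g _ k })
          (λ { (refl , l) k → _ , k , refl , ≼-trans l k })
          (λ { (refl , l) k → _ , k , refl , ≼-trans l k })
          γ sorted (refl , here)) p)

      correct-δ : ∀ {k} (c : Code k) → Reduced (full k) c → c ⊩ γ ⇒ ⋀ (map θ choices) ⇒ covered ⇒ (var y ⇔ δ)
      correct-δ c r c₁ l₁ p c₂ l₂ q c₃ l₃ a = to , from
        where
        r₁ = reduced-≼ r l₁

        holds : ∀ {d} → c₃ ≼ d → d ⊩ γ
        holds l = persistence (reduced⇒persistent c₁ r₁) γ (≼-trans l₂ (≼-trans l₃ l)) p

        to : c₃ ⊩ var y ⇒ δ
        to d l v =
          let (σ , σ∈ , _ , b) = proj₁ (⊩-join _ _ choices) a
              b′ = persistence (reduced⇒persistent c₃ (reduced-≼ r₁ (≼-trans l₂ l₃))) (agreement zs σ) l b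
          in proj₂ (⊩-join _ _ choices) (σ , σ∈ , refl , replace σ σ∈ b′ (holds l) ,
               proj₁ (proj₁ b′) d here v)

        from : c₃ ⊩ δ ⇒ var y
        from d l v =
          let (σ , σ∈ , _ , (s , t)) = proj₁ (⊩-join _ _ choices) v in
          proj₂ (proj₁ (⊩-⋀ (map θ choices)) q (∈-map⁺ θ σ∈) d (≼-trans l₃ l) (holds l) d here s) d here t

theorem7p4 : (L : IntermediateLogic) → VarietyWithinDHA L
    → HereditarilyStructurallyComplete L × InfiniteBeth L
theorem7p4 L within =
  hereditarilyStructurallyComplete L within ,
  λ X Y disjoint Γ hΓ c c-X c-inj c-fresh implicit →
    explicit L within X Y disjoint Γ hΓ c c-X c-inj c-fresh implicit
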